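{- For every $n\ge 0$, $$\sum_{\sigma\in\mathfrak S_n} s^{\mathrm{lec}\,\sigma}\,t^{\mathrm{ides}\,\sigma}\,q^{\mathrm{imaj}\,\sigma}\,Y^{\mathrm{pix}\,\sigma}=A_n(s,t,q,Y),$$ where the polynomials $A_n(s,t,q,Y)$ are defined by the identity of formal power series $$\sum_{r\ge 0}t^r\,\frac{(1-qs)\,(u;q)_r\,(usq;q)_r}{\bigl((u;q)_r-sq\,(usq;q)_r\bigr)\,(uY;q)_{r+1}}=\sum_{n\ge 0}A_n(s,t,q,Y)\,\frac{u^n}{(t;q)_{n+1}}.$$
   Context: $(a;q)_0=1$, $(a;q)_n=(1-a)(1-aq)\cdots(1-aq^{n-1})$. For $\sigma\in\mathfrak S_n$: $\mathrm{des}\,\sigma=\#\{i\le n-1:\sigma(i)>\sigma(i+1)\}$, $\mathrm{maj}\,\sigma=\sum_{i\le n-1,\ \sigma(i)>\sigma(i+1)} i$, $\mathrm{ides}\,\sigma=\mathrm{des}\,\sigma^{ -1}$, $\mathrm{imaj}\,\sigma=\mathrm{maj}\,\sigma^{ -1}$. A hook is a word $x_1\cdots x_m$ of distinct positive integers with $m\ge2$, $x_1>x_2$, and either $m=2$ or $x_2<x_3<\cdots<x_m$. Every permutation $\sigma$ (as a word $\sigma(1)\cdots\sigma(n)$) has a unique factorization $p\,\tau_1\tau_2\cdots\tau_k$ (its hook factorization) where $p$ is an increasing word (possibly empty) and each $\tau_i$ is a hook. Then $\mathrm{pix}\,\sigma$ is the length of $p$, and $\mathrm{lec}\,\sigma=\sum_{i=1}^k\mathrm{inv}\,\tau_i$,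 where $\mathrm{inv}$ of a word is its number of pairs of positions $a<b$ with the letter at $a$ greater than the letter at $b$. -}

module Defs where

open import Data.Nat using (ℕ; zero; suc; _∸_; _<ᵇ_; _≡ᵇ_)
  renaming (_+_ to _+ℕ_)
open import Data.Integer using (ℤ; 0ℤ; 1ℤ; _+_; _*_; _-_)
open import Data.List using (List; []; _∷_; map; foldr; length; concatMap; filterᵇ; upTo)
open import Data.Bool using (Bool; true; false; if_then_else_; _∧_; _∨_; not)
open import Data.Product using (_×_; _,_; proj₁; proj₂)
open import Relation.Binary.PropositionalEquality using (_≡_)

-- Formal power series in the five variables s, t, q, Y, u with integer
-- coefficients:  f a b c d e  is the coefficient of  s^a t^b q^c Y^d u^e.

PS : Set
PS = ℕ → ℕ → ℕ → ℕ → ℕ → ℤ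

infix 4 _≈_
_≈_ : PS → PS → Set
f ≈ g = ∀ a b c d e → f a b c d e ≡ g a b c d e

sumTo : ℕ → (ℕ → ℤ) → ℤ
sumTo zero h = h 0
sumTo (suc n) h = sumTo n h + h (suc n)

infixl 6 _⊕_ _⊖_
infixl 7 _⊛_

_⊕_ : PS → PS → PS
(f ⊕ g) a b c d e = f a b c d e + g a b c d e

_⊖_ : PS → PS → PS
(f ⊖ g) a b c d e = f a b c d e - g a b c d e

_⊛_ : PS → PS → PS
(f ⊛ g) a b c d e =
  sumTo a λ a₁ → sumTo b λ b₁ → sumTo c λ c₁ → sumTo d λ d₁ → sumTo e λ e₁ →
    f a₁ b₁ c₁ d₁ e₁ * g (a ∸ a₁) (b ∸ b₁) (c ∸ c₁) (d ∸ d₁) (e ∸ e₁)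

δ : ℕ → ℕ → ℤ
δ m n = if m ≡ᵇ n then 1ℤ else 0ℤ

mono : ℕ → ℕ → ℕ → ℕ → ℕ → PS
mono a b c d e a' b' c' d' e' = δ a a' * δ b b' * δ c c' * δ d d' * δ e e'

𝟘 : PS
𝟘 _ _ _ _ _ = 0ℤ

𝟙 : PS
𝟙 = mono 0 0 0 0 0

S T Q Yv U : PS
S  = mono 1 0 0 0 0
T  = mono 0 1 0 0 0
Q  = mono 0 0 1 0 0
Yv = mono 0 0 0 1 0
U  = mono 0 0 0 0 1

pow : PS → ℕ → PS
pow x zero = 𝟙
pow x (suc n) = pow x n ⊛ x

poch : PS → ℕ → PS
poch a zero = 𝟙
poch a (suc n) = poch a n ⊛ (𝟙 ⊖ a ⊛ pow Q n)

-- Σ_{r ≥ 0} t^r G_r   (well defined: only r ≤ b contributes to t^b)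
tsum : (ℕ → PS) → PS
tsum G a b c d e = sumTo b λ r → G r a (b ∸ r) c d e

-- Σ_{n ≥ 0} u^n F_n   (well defined: only n ≤ e contributes to u^e)
usum : (ℕ → PS) → PS
usum F a b c d e = sumTo e λ n → F n a b c d (e ∸ n)

-- Permutations as words σ(1)…σ(n) (lists of naturals).

b2n : Bool → ℕ
b2n true = 1
b2n false = 0

countLt : ℕ → List ℕ → ℕ
countLt x [] = 0
countLt x (y ∷ ys) = b2n (y <ᵇ x) +ℕ countLt x ys

inv : List ℕ → ℕ
inv [] = 0
inv (x ∷ xs) = countLt x xs +ℕ inv xs

des : List ℕ → ℕ
des (x ∷ y ∷ ys) = b2n (y <ᵇ x) +ℕ des (y ∷ ys)
des _ = 0

majFrom : ℕ → List ℕ → ℕ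
majFrom i (x ∷ y ∷ ys) = (if y <ᵇ x then i else 0) +ℕ majFrom (suc i) (y ∷ ys)
majFrom i _ = 0

maj : List ℕ → ℕ
maj = majFrom 1

indexOf : ℕ → List ℕ → ℕ
indexOf v [] = 0
indexOf v (x ∷ xs) = if v ≡ᵇ x then 1 else suc (indexOf v xs)

range1 : ℕ → List ℕ
range1 n = map suc (upTo n)

inverse : List ℕ → List ℕ
inverse w = map (λ i → indexOf i w) (range1 (length w))

ides : List ℕ → ℕ
ides w = des (inverse w)

imaj : List ℕ → ℕ
imaj w = maj (inverse w)

-- Hook factorization, computed from the right on the reversed word:
-- the last hook x₁x₂…x_m consists of the increasing final run x₂<…<x_m
-- preceded by x₁ > x₂; if there is no descent, the rest is the
-- increasing prefix p.  Returns (pix, lec) = (length p, Σ inv τᵢ).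
mutual
  hookRev : List ℕ → ℕ × ℕ
  hookRev [] = 0 , 0
  hookRev (y ∷ ys) = hookStep (y ∷ []) y ys

  -- h : current increasing final run (forward order), z : its first letter,
  -- rest : the remaining word, reversed
  hookStep : List ℕ → ℕ → List ℕ → ℕ × ℕ
  hookStep h z [] = length h , 0
  hookStep h z (x ∷ xs) with z <ᵇ x
  ... | true  = proj₁ (hookRev xs) , proj₂ (hookRev xs) +ℕ inv (x ∷ h)
  ... | false = hookStep (x ∷ h) x xs

revℕ : List ℕ → List ℕ
revℕ = foldr (λ x acc → acc Data.List.++ (x ∷ [])) []

pix : List ℕ → ℕ
pix w = proj₁ (hookRev (revℕ w))

lec : List ℕ → ℕ
lec w = proj₂ (hookRev (revℕ w))

words : ℕ → ℕ → List (List ℕ)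
words n zero = [] ∷ []
words n (suc k) = concatMap (λ w → map (λ x → x ∷ w) (range1 n)) (words n k)

member : ℕ → List ℕ → Bool
member v [] = false
member v (x ∷ xs) = (v ≡ᵇ x) ∨ member v xs

distinct : List ℕ → Bool
distinct [] = true
distinct (x ∷ xs) = not (member x xs) ∧ distinct xs

perms : ℕ → List (List ℕ)
perms n = filterᵇ distinct (words n n)

permPoly : ℕ → PS
permPoly n = foldr (λ w acc → mono (lec w) (ides w) (imaj w) (pix w) 0 ⊕ acc) 𝟘 (perms n)

numer : ℕ → PS
numer r = (𝟙 ⊖ Q ⊛ S) ⊛ poch U r ⊛ poch (U ⊛ S ⊛ Q) r

denom : ℕ → PS
denom r = (poch U r ⊖ S ⊛ Q ⊛ poch (U ⊛ S ⊛ Q) r) ⊛ poch (U ⊛ Yv) (suc r)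

-- Sorting a word of length n over 1, …, r + 1 lexicographically by (letter, position)
-- encodes it as its standardization σ together with a weakly increasing word that is strict
-- at the descents of σ⁻¹; comparisons, hence lec and pix, are those of σ.  Weighting the
-- letter x by q^(r+1-x), summation over such increasing words and over t^r gives
-- t^ides q^imaj / (t;q)_{n+1} (MacMahon), so the coefficient of t^r on the right-hand side
-- is the generating function Ψ of all words over r + 1 letters by length, weight, lec and pix.
-- Reading words from right to left, the hook factorization is an automaton whose state is
-- the current increasing run.  Its linear recursion determines Ψ and is solved explicitly:
-- Ψ (1 - L) = 1/(uY;q)_{r+1}, where L enumerates single hooks, and a telescoping sum gives
-- (1 - sq)(1 - L) = 1/(usq;q)_r - sq/(u;q)_r.
module Submission where

import Algebra.Construct.Pointwise as Pointwise
import Algebra.Properties.AbelianGroup as AbelianGroupProperties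
import Algebra.Properties.CommutativeSemigroup as CommutativeSemigroupProperties
import Algebra.Properties.CommutativeSemiring.Exp as Exp
import Algebra.Properties.Ring as RingProperties
import Algebra.Properties.Semiring.Mult.TCOptimised as Mult
import Algebra.Solver.Ring
open import Algebra.Bundles using (CommutativeRing)
open import Algebra.Solver.Ring.AlmostCommutativeRing using (fromCommutativeRing; _-Raw-AlmostCommutative⟶_)
open import Data.Bool as Bool using (true; false; if_then_else_; not)
import Data.Bool.Properties as Bool
open import Data.Integer as ℤ using (ℤ; 0ℤ; 1ℤ)
import Data.Integer.Properties as ℤ
open import Data.List using (List; []; _∷_; _++_; map; foldr; concatMap; length; upTo; reverse; zip)
import Data.List.Properties as List
open import Data.List.Membership.Propositional using (_∈_; find; lose)
open import Data.List.Membership.Propositional.Properties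
open import Data.List.Membership.Propositional.Properties.WithK using (unique∧set⇒bag)
open import Data.List.Relation.Binary.BagAndSetEquality using (∼bag⇒↭)
open import Data.List.Relation.Binary.Permutation.Propositional as Perm
  using (_↭_; ↭-refl; ↭-sym; ↭-trans; ↭-prep; ↭-reflexive; ↭⇒↭ₛ)
import Data.List.Relation.Binary.Permutation.Propositional.Properties as Perm
import Data.List.Relation.Binary.Permutation.Setoid.Properties as PermSetoid
import Data.List.Relation.Binary.Pointwise as PW
open import Data.List.Relation.Unary.All as All using (All; []; _∷_)
import Data.List.Relation.Unary.All.Properties as All
open import Data.List.Relation.Unary.AllPairs as AllPairs using (AllPairs; []; _∷_)
import Data.List.Relation.Unary.AllPairs.Properties as AllPairs
open import Data.List.Relation.Unary.Any using (here; there)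
open import Data.List.Relation.Unary.Linked using (Linked; []; [-]; _∷_)
import Data.List.Relation.Unary.Linked.Properties as Linked
open import Data.List.Relation.Unary.Sorted.TotalOrder.Properties using (↗↭↗⇒≋)
open import Data.List.Relation.Unary.Unique.Propositional using (Unique)
import Data.List.Relation.Unary.Unique.Propositional.Properties as Unique
import Data.List.Sort as Sort
open import Data.Maybe using (Maybe; just; nothing)
open import Data.Nat as ℕ using (ℕ; zero; suc; _∸_; _≤_; _<_; z≤n; s≤s; _<ᵇ_; _≡ᵇ_)
import Data.Nat.Properties as ℕ
open import Data.Product using (_,_; _×_; proj₁; proj₂; Σ-syntax)
open import Data.Product.Properties using () renaming (≡-dec to ×-≡-dec)
open import Data.Product.Relation.Binary.Lex.Strict
  using (×-Lex; ×-transitive; ×-antisymmetric; ×-total₂; ×-decidable)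
open import Data.Sum using (inj₁; inj₂; [_,_]′)
open import Function using (_∘_; flip; mk⇔)
open import Level using (0ℓ)
open import Relation.Binary using (DecTotalOrder; tri<; tri≈; tri>)
import Relation.Binary.Reasoning.Setoid as SetoidReasoning
open import Relation.Binary.PropositionalEquality as ≡ using (_≡_; _≢_; cong; cong₂)
open import Relation.Nullary using (¬_; contradiction; yes; no)
open import Defs hiding (_≈_)

-- The state of the automaton is a whole run `h`, so the linear system has infinitely many unknowns
-- `Φ h z`. It is solvable because the continuation sees `h` only through its length, its first
-- letter z and `A> h z`, the weighted sum of the letters above z that would close the run:
-- prepending x adds one inversion for every letter above x, and letters at most z exceed nothing in
-- `h`. The closed form `Φ′` is not derived but verified, and uniqueness finishes the argument: the
-- unknowns occur under a factor u, so two solutions that agree below total degree k agree below k +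
-- 1. The same contraction principle yields linearity of the infinite sums and cancellation of
-- factors 1 - v with v of positive degree. The quotient in r is handled by multiplying out: `Ψ`
-- satisfies the equation that defines `G r`, and cancellation identifies the two. All this takes
-- place over an abstract interface, since the product of the statement is a five-fold nested sum.

-- What the argument uses of power series.  x ≈[ k ] y means that x and y agree
-- in all total degrees below k.
record SeriesAlgebra : Set₁ where
  infix 4 _≈[_]_
  field
    commutativeRing : CommutativeRing 0ℓ 0ℓ
  open CommutativeRing commutativeRing using (Carrier; _+_; _*_) renaming (_≈_ to _≈ᵣ_)
  field
    s t q Y u : Carrier
    usum* tsum* : (ℕ → Carrier) → Carrier
    usum-cong   : ∀ {F G} → (∀ n → F n ≈ᵣ G n) → usum* F ≈ᵣ usum* G
    tsum-cong   : ∀ {F G} → (∀ n → F n ≈ᵣ G n) → tsum* F ≈ᵣ tsum* G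
    usum-unfold : ∀ F → usum* F ≈ᵣ F 0 + u * usum* (F ∘ suc)
    tsum-unfold : ∀ F → tsum* F ≈ᵣ F 0 + t * tsum* (F ∘ suc)
    usum-tsum   : ∀ (F : ℕ → ℕ → Carrier) → usum* (λ n → tsum* (F n)) ≈ᵣ tsum* (λ r → usum* (λ n → F n r))
    _≈[_]_      : Carrier → ℕ → Carrier → Set
    ≈[]-zero    : ∀ {x y} → x ≈[ 0 ] y
    ≈[]-trans   : ∀ {k x y z} → x ≈[ k ] y → y ≈[ k ] z → x ≈[ k ] z
    ≈⇒≈[]       : ∀ {k x y} → x ≈ᵣ y → x ≈[ k ] y
    ≈[]⇒≈       : ∀ {x y} → (∀ k → x ≈[ k ] y) → x ≈ᵣ y
    ≈[]-+       : ∀ {k x x′ y y′} → x ≈[ k ] x′ → y ≈[ k ] y′ → x + y ≈[ k ] x′ + y′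
    ≈[]-*       : ∀ {k x x′ y y′} → x ≈[ k ] x′ → y ≈[ k ] y′ → x * y ≈[ k ] x′ * y′
    raise-u     : ∀ {k x y} → x ≈[ k ] y → u * x ≈[ suc k ] u * y
    raise-t     : ∀ {k x y} → x ≈[ k ] y → t * x ≈[ suc k ] t * y
    raise-q     : ∀ {k x y} → x ≈[ k ] y → q * x ≈[ suc k ] q * y

-- A ring solver with integer coefficients, so that terms over an abstract ring cancel.
module IntegerCoefficients (R : CommutativeRing 0ℓ 0ℓ) where
  open CommutativeRing R hiding (zero)
  open RingProperties ring using (-‿distribˡ-*; -‿distribʳ-*; -0#≈0#)
  open AbelianGroupProperties +-abelianGroup using (⁻¹-∙-comm; ⁻¹-involutive)
  open Mult semiring using (1+×; ×-homo-+; ×1-homo-*) renaming (_×_ to _·_)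
  open SetoidReasoning setoid

  private
    fromℤ : ℤ → Carrier
    fromℤ (ℤ.+ n)    = n · 1#
    fromℤ ℤ.-[1+ n ] = - (suc n · 1#)

    ≡⇒≈ : ∀ {i j} → i ≡ j → fromℤ i ≈ fromℤ j
    ≡⇒≈ p = reflexive (cong fromℤ p)

    fromℤ-⊖ : ∀ m n → fromℤ (m ℤ.⊖ n) ≈ m · 1# - n · 1#
    fromℤ-⊖ zero    zero    = sym (-‿inverseʳ 0#)
    fromℤ-⊖ zero    (suc n) = sym (+-identityˡ _)
    fromℤ-⊖ (suc m) zero    = sym (trans (+-congˡ -0#≈0#) (+-identityʳ _))
    fromℤ-⊖ (suc m) (suc n) = begin
      fromℤ (suc m ℤ.⊖ suc n)                ≈⟨ ≡⇒≈ (ℤ.[1+m]⊖[1+n]≡m⊖n m n) ⟩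
      fromℤ (m ℤ.⊖ n)                        ≈⟨ fromℤ-⊖ m n ⟩
      m · 1# - n · 1#                        ≈⟨ +-congˡ (+-identityˡ _) ⟨
      m · 1# + (0# - n · 1#)                 ≈⟨ +-congˡ (+-congʳ (-‿inverseʳ 1#)) ⟨
      m · 1# + ((1# - 1#) - n · 1#)          ≈⟨ +-congˡ (+-assoc _ _ _) ⟩
      m · 1# + (1# + (- 1# - n · 1#))        ≈⟨ +-assoc _ _ _ ⟨
      (m · 1# + 1#) + (- 1# - n · 1#)        ≈⟨ +-cong (+-comm _ _) (⁻¹-∙-comm _ _) ⟩
      (1# + m · 1#) - (1# + n · 1#)          ≈⟨ +-cong (1+× m 1#) (-‿cong (1+× n 1#)) ⟨
      suc m · 1# - suc n · 1#                ∎

    fromℤ-neg : ∀ i → fromℤ (ℤ.- i) ≈ - fromℤ i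
    fromℤ-neg (ℤ.+ zero)  = sym -0#≈0#
    fromℤ-neg (ℤ.+ suc n) = refl
    fromℤ-neg ℤ.-[1+ n ]  = sym (⁻¹-involutive _)

    fromℤ-+ : ∀ i j → fromℤ (i ℤ.+ j) ≈ fromℤ i + fromℤ j
    fromℤ-+ (ℤ.+ m)    (ℤ.+ n)    = ×-homo-+ 1# m n
    fromℤ-+ (ℤ.+ m)    ℤ.-[1+ n ] = fromℤ-⊖ m (suc n)
    fromℤ-+ ℤ.-[1+ m ] (ℤ.+ n)    = trans (fromℤ-⊖ n (suc m)) (+-comm _ _)
    fromℤ-+ ℤ.-[1+ m ] ℤ.-[1+ n ] = begin
      fromℤ (ℤ.-[1+ m ] ℤ.+ ℤ.-[1+ n ]) ≈⟨ ≡⇒≈ (ℤ.neg-distrib-+ (ℤ.+ suc m) (ℤ.+ suc n)) ⟨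
      - ((suc m ℕ.+ suc n) · 1#)        ≈⟨ -‿cong (×-homo-+ 1# (suc m) (suc n)) ⟩
      - (suc m · 1# + suc n · 1#)       ≈⟨ ⁻¹-∙-comm _ _ ⟨
      - (suc m · 1#) - suc n · 1#       ∎

    fromℤ-*⁺ : ∀ m j → fromℤ (ℤ.+ m ℤ.* j) ≈ fromℤ (ℤ.+ m) * fromℤ j
    fromℤ-*⁺ m (ℤ.+ n) = trans (≡⇒≈ (≡.sym (ℤ.pos-* m n))) (×1-homo-* m n)
    fromℤ-*⁺ m ℤ.-[1+ n ] = begin
      fromℤ (ℤ.+ m ℤ.* ℤ.-[1+ n ])       ≈⟨ ≡⇒≈ (ℤ.neg-distribʳ-* (ℤ.+ m) (ℤ.+ suc n)) ⟨
      fromℤ (ℤ.- (ℤ.+ m ℤ.* ℤ.+ suc n))  ≈⟨ fromℤ-neg (ℤ.+ m ℤ.* ℤ.+ suc n) ⟩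
      - fromℤ (ℤ.+ m ℤ.* ℤ.+ suc n)      ≈⟨ -‿cong (fromℤ-*⁺ m (ℤ.+ suc n)) ⟩
      - (m · 1# * suc n · 1#)            ≈⟨ -‿distribʳ-* _ _ ⟩
      m · 1# * - (suc n · 1#)            ∎

    fromℤ-* : ∀ i j → fromℤ (i ℤ.* j) ≈ fromℤ i * fromℤ j
    fromℤ-* (ℤ.+ m)    j = fromℤ-*⁺ m j
    fromℤ-* ℤ.-[1+ m ] j = begin
      fromℤ (ℤ.-[1+ m ] ℤ.* j)        ≈⟨ ≡⇒≈ (ℤ.neg-distribˡ-* (ℤ.+ suc m) j) ⟨
      fromℤ (ℤ.- (ℤ.+ suc m ℤ.* j))   ≈⟨ fromℤ-neg (ℤ.+ suc m ℤ.* j) ⟩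
      - fromℤ (ℤ.+ suc m ℤ.* j)       ≈⟨ -‿cong (fromℤ-*⁺ (suc m) j) ⟩
      - (suc m · 1# * fromℤ j)        ≈⟨ -‿distribˡ-* _ _ ⟩
      - (suc m · 1#) * fromℤ j        ∎

    morphism : ℤ.+-*-rawRing -Raw-AlmostCommutative⟶ fromCommutativeRing R
    morphism = record
      { ⟦_⟧    = fromℤ
      ; +-homo = fromℤ-+
      ; *-homo = fromℤ-*
      ; -‿homo = fromℤ-neg
      ; 0-homo = refl
      ; 1-homo = refl
      }

    weaklyDecidable : ∀ i j → Maybe (fromℤ i ≈ fromℤ j)
    weaklyDecidable i j with i ℤ.≟ j
    ... | yes i≡j = just (≡⇒≈ i≡j)
    ... | no _    = nothing

  open Algebra.Solver.Ring ℤ.+-*-rawRing (fromCommutativeRing R) morphism weaklyDecidable public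
    using (solve; _:=_; _:+_; _:*_; _:-_; :-_; con)

-- Comparisons and single steps of the hook automaton

<ᵇ-true : ∀ {m n} → m < n → (m <ᵇ n) ≡ true
<ᵇ-true {m} {n} m<n with m <ᵇ n in eq
... | true  = ≡.refl
... | false with () ← ≡.subst Bool.T eq (ℕ.<⇒<ᵇ m<n)

<ᵇ-false : ∀ {m n} → n ≤ m → (m <ᵇ n) ≡ false
<ᵇ-false {m} {n} n≤m with m <ᵇ n in eq
... | false = ≡.refl
... | true  = contradiction (ℕ.<ᵇ⇒< m n (≡.subst Bool.T (≡.sym eq) _)) (ℕ.≤⇒≯ n≤m)

if-<ᵇ : ∀ {B : Set} {m n} {x y : B} → m < n → (if m <ᵇ n then x else y) ≡ x
if-<ᵇ m<n rewrite <ᵇ-true m<n = ≡.refl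

if-≮ᵇ : ∀ {B : Set} {m n} {x y : B} → n ≤ m → (if m <ᵇ n then x else y) ≡ y
if-≮ᵇ n≤m rewrite <ᵇ-false n≤m = ≡.refl

countLt-≤ : ∀ x h → All (x ≤_) h → countLt x h ≡ 0
countLt-≤ x []      []        = ≡.refl
countLt-≤ x (y ∷ h) (x≤y ∷ p) rewrite <ᵇ-false x≤y = countLt-≤ x h p

hookStep-∷ : ∀ h z x w → hookStep h z (x ∷ w) ≡
  (if z <ᵇ x then (proj₁ (hookRev w) , proj₂ (hookRev w) ℕ.+ inv (x ∷ h)) else hookStep (x ∷ h) x w)
hookStep-∷ h z x w with z <ᵇ x
... | true  = ≡.refl
... | false = ≡.refl

-- No letter exceeds `N`, so the first letter read never closes the empty run. The start of the scan
-- thereby becomes an ordinary state, governed by the same recursion as all others.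
hookStep-initial : ∀ N w → All (_≤ N) w → hookStep [] N w ≡ hookRev w
hookStep-initial N []      _         = ≡.refl
hookStep-initial N (y ∷ w) (y≤N ∷ _) = ≡.trans (hookStep-∷ [] N y w) (if-≮ᵇ y≤N)

desAt : ℕ → List ℕ → ℕ
desAt x []      = 0
desAt x (y ∷ _) = b2n (y <ᵇ x)

-- Lists without repetition

-- Pigeonhole principle; it turns a distinct word of length n over n letters into a rearrangement of
-- `range1 n`.
unique∧⊆⇒↭ : ∀ {B : Set} {xs ys : List B} → Unique xs → (∀ {x} → x ∈ xs → x ∈ ys) → length ys ≤ length xs → xs ↭ ys
unique∧⊆⇒↭ {xs = []} {[]} _ _ _ = ↭-refl
unique∧⊆⇒↭ {xs = x ∷ xs} {ys} (x∉xs ∷ xs!) xs⊆ys len with ∈-∃++ (xs⊆ys (here ≡.refl))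
... | ys₁ , ys₂ , ≡.refl = ↭-trans (↭-prep x (unique∧⊆⇒↭ xs! xs⊆ys′ len′)) (↭-sym x∷ys′)
  where
  x∷ys′ : ys₁ ++ x ∷ ys₂ ↭ x ∷ ys₁ ++ ys₂
  x∷ys′ = Perm.shift x ys₁ ys₂
  xs⊆ys′ : ∀ {y} → y ∈ xs → y ∈ ys₁ ++ ys₂
  xs⊆ys′ y∈xs with Perm.∈-resp-↭ x∷ys′ (xs⊆ys (there y∈xs))
  ... | here ≡.refl = contradiction ≡.refl (All.lookup x∉xs y∈xs)
  ... | there y∈  = y∈
  len′ : length (ys₁ ++ ys₂) ≤ length xs
  len′ = ℕ.≤-pred (≡.subst (_≤ suc (length xs)) (Perm.↭-length x∷ys′) len)

unique-concatMap : ∀ {B C : Set} (f : B → List C) {xs} → Unique xs → (∀ x → Unique (f x)) →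
                   (∀ {x y z} → z ∈ f x → z ∈ f y → x ≡ y) → Unique (concatMap f xs)
unique-concatMap f {xs} xs! f! sep =
  Unique.concat⁺ (All.map⁺ (All.tabulate (λ {x} _ → f! x)))
                 (AllPairs.map⁺ (AllPairs.map (λ x≢y {_} (z∈fx , z∈fy) → x≢y (sep z∈fx z∈fy)) xs!))

-- Between lists without repetition, equality as sets is equality as bags, so mutually inverse maps
-- suffice. Sums are reindexed along bijections in this form.
bijection⇒↭ : ∀ {B C : Set} {xs : List B} {ys : List C} (φ : B → C) (ψ : C → B) → Unique xs → Unique ys →
  (∀ {x} → x ∈ xs → φ x ∈ ys) → (∀ {x} → x ∈ xs → ψ (φ x) ≡ x) →
  (∀ {y} → y ∈ ys → ψ y ∈ xs) → (∀ {y} → y ∈ ys → φ (ψ y) ≡ y) → map φ xs ↭ ys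
bijection⇒↭ {xs = xs} {ys} φ ψ xs! ys! φ∈ ψφ ψ∈ φψ =
  ∼bag⇒↭ (unique∧set⇒bag (unique-map xs! ψφ) ys! (mk⇔ to from))
  where
  unique-map : ∀ {xs} → Unique xs → (∀ {x} → x ∈ xs → ψ (φ x) ≡ x) → Unique (map φ xs)
  unique-map []           _  = []
  unique-map (x∉xs ∷ xs!) ψφ =
    All.map⁺ (All.tabulate (λ y∈xs φx≡φy → All.lookup x∉xs y∈xs
      (≡.trans (≡.sym (ψφ (here ≡.refl))) (≡.trans (cong ψ φx≡φy) (ψφ (there y∈xs))))))
    ∷ unique-map xs! (ψφ ∘ there)
  to : ∀ {y} → y ∈ map φ xs → y ∈ ys
  to y∈ with ∈-map⁻ φ y∈
  ... | x , x∈xs , ≡.refl = φ∈ x∈xs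
  from : ∀ {y} → y ∈ ys → y ∈ map φ xs
  from y∈ = ≡.subst (_∈ map φ xs) (φψ y∈) (∈-map⁺ φ (ψ∈ y∈))

-- Words and permutations

∈-range1⁺ : ∀ {n i} → i < n → suc i ∈ range1 n
∈-range1⁺ i<n = ∈-map⁺ suc (∈-upTo⁺ i<n)

∈-range1⁻ : ∀ {n v} → v ∈ range1 n → 1 ≤ v × v ≤ n
∈-range1⁻ v∈ with ∈-map⁻ suc v∈
... | i , i∈ , ≡.refl = s≤s z≤n , ∈-upTo⁻ i∈

range1-suc : ∀ n → range1 (suc n) ≡ 1 ∷ map suc (range1 n)
range1-suc n = cong (λ l → 1 ∷ map suc l) (≡.sym (List.map-upTo suc n))

length-range1 : ∀ n → length (range1 n) ≡ n
length-range1 n = ≡.trans (List.length-map suc (upTo n)) (List.length-upTo n)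

range1-< : ∀ n → AllPairs _<_ (range1 n)
range1-< n = AllPairs.map⁺ (AllPairs.map s≤s (AllPairs.applyUpTo⁺₁ (λ i → i) n (λ i<j _ → i<j)))

range1-unique : ∀ n → Unique (range1 n)
range1-unique n = AllPairs.map ℕ.<⇒≢ (range1-< n)

∈-words⁺ : ∀ N k {w} → length w ≡ k → All (_∈ range1 N) w → w ∈ words N k
∈-words⁺ N zero    {[]}    _   _        = here ≡.refl
∈-words⁺ N (suc k) {x ∷ w} len (x∈ ∷ p) =
  ∈-concatMap⁺ (λ w → map (_∷ w) (range1 N)) (lose (∈-words⁺ N k (ℕ.suc-injective len) p) (∈-map⁺ (_∷ w) x∈))

∈-words⁻ : ∀ N k {w} → w ∈ words N k → length w ≡ k × All (_∈ range1 N) w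
∈-words⁻ N zero    (here ≡.refl) = ≡.refl , []
∈-words⁻ N (suc k) w∈ with find (∈-concatMap⁻ (λ w → map (_∷ w) (range1 N)) w∈)
... | w′ , w′∈ , x∷w′∈ with ∈-map⁻ (_∷ w′) x∷w′∈ | ∈-words⁻ N k w′∈
...   | x , x∈ , ≡.refl | len , p = cong suc len , x∈ ∷ p

words-unique : ∀ N k → Unique (words N k)
words-unique N zero    = [] ∷ []
words-unique N (suc k) = unique-concatMap (λ w → map (_∷ w) (range1 N)) (words-unique N k)
  (λ w → Unique.map⁺ List.∷-injectiveˡ (range1-unique N)) sep
  where
  sep : ∀ {w w′ z} → z ∈ map (_∷ w) (range1 N) → z ∈ map (_∷ w′) (range1 N) → w ≡ w′
  sep {w} {w′} z∈ z∈′ with ∈-map⁻ (_∷ w) z∈ | ∈-map⁻ (_∷ w′) z∈′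
  ... | _ , _ , ≡.refl | _ , _ , eq = List.∷-injectiveʳ eq

words-≤ : ∀ {N n w} → w ∈ words N n → All (_≤ N) w
words-≤ {N} {n} w∈ = All.map (proj₂ ∘ ∈-range1⁻) (proj₂ (∈-words⁻ N n w∈))

T-≡ᵇ : ∀ {x y} → x ≡ y → (x ≡ᵇ y) ≡ true
T-≡ᵇ {x} {y} x≡y with x ≡ᵇ y in eq
... | true  = ≡.refl
... | false = contradiction (ℕ.≡⇒≡ᵇ x y x≡y) (≡.subst (¬_ ∘ Bool.T) (≡.sym eq) (λ ()))

≢⇒≡ᵇ-false : ∀ {x y} → x ≢ y → (x ≡ᵇ y) ≡ false
≢⇒≡ᵇ-false {x} {y} x≢y with x ≡ᵇ y in eq
... | false = ≡.refl
... | true  = contradiction (ℕ.≡ᵇ⇒≡ x y (≡.subst Bool.T (≡.sym eq) _)) x≢y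

member-false⁻ : ∀ v l → Bool.T (not (member v l)) → All (v ≢_) l
member-false⁻ v []      _ = []
member-false⁻ v (x ∷ l) p with v ℕ.≟ x
... | yes v≡x rewrite T-≡ᵇ v≡x = contradiction p (λ ())
... | no  v≢x rewrite ≢⇒≡ᵇ-false v≢x = v≢x ∷ member-false⁻ v l p

member-false⁺ : ∀ {v l} → All (v ≢_) l → Bool.T (not (member v l))
member-false⁺ []        = _
member-false⁺ (v≢x ∷ p) rewrite ≢⇒≡ᵇ-false v≢x = member-false⁺ p

distinct⇒unique : ∀ l → Bool.T (distinct l) → Unique l
distinct⇒unique []      _ = []
distinct⇒unique (x ∷ l) p with member x l in eq
... | false = member-false⁻ x l (≡.subst (Bool.T ∘ not) (≡.sym eq) _) ∷ distinct⇒unique l p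

unique⇒distinct : ∀ {l} → Unique l → Bool.T (distinct l)
unique⇒distinct []                 = _
unique⇒distinct {x ∷ l} (x∉l ∷ l!) with member x l | member-false⁺ x∉l
... | false | _ = unique⇒distinct l!

unique-resp-↭ : ∀ {xs ys : List ℕ} → xs ↭ ys → Unique xs → Unique ys
unique-resp-↭ p = PermSetoid.Unique-resp-↭ (≡.setoid ℕ) (↭⇒↭ₛ p)

∈-perms⁻ : ∀ {n σ} → σ ∈ perms n → σ ↭ range1 n
∈-perms⁻ {n} {σ} σ∈ with ∈-filter⁻ (Bool.T? ∘ distinct) {xs = words n n} σ∈
... | σ∈words , σ! with ∈-words⁻ n n σ∈words
...   | len , p = unique∧⊆⇒↭ (distinct⇒unique σ σ!) (All.lookup p) (ℕ.≤-reflexive (≡.trans (length-range1 n) (≡.sym len)))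

∈-perms⁺ : ∀ {n σ} → σ ↭ range1 n → σ ∈ perms n
∈-perms⁺ {n} σ↭ = ∈-filter⁺ (Bool.T? ∘ distinct)
  (∈-words⁺ n n (≡.trans (Perm.↭-length σ↭) (length-range1 n)) (All.tabulate (Perm.∈-resp-↭ σ↭)))
  (unique⇒distinct (unique-resp-↭ (↭-sym σ↭) (range1-unique n)))

perms-unique : ∀ n → Unique (perms n)
perms-unique n = Unique.filter⁺ (Bool.T? ∘ distinct) (words-unique n n)

-- Letters by position (counted from 1, with 0 outside the word)

infix 8 _!_
_!_ : List ℕ → ℕ → ℕ
[]      ! _           = 0
(x ∷ l) ! zero        = 0
(x ∷ l) ! suc zero    = x
(x ∷ l) ! suc (suc i) = l ! suc i

map-! : ∀ l → map (l !_) (range1 (length l)) ≡ l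
map-! []      = ≡.refl
map-! (x ∷ l) = begin
  map ((x ∷ l) !_) (range1 (suc n))                       ≡⟨ cong (map ((x ∷ l) !_)) (range1-suc n) ⟩
  x ∷ map ((x ∷ l) !_) (map suc (map suc (upTo n)))       ≡⟨ cong (x ∷_) (≡.sym (List.map-∘ (map suc (upTo n)))) ⟩
  x ∷ map (((x ∷ l) !_) ∘ suc) (map suc (upTo n))           ≡⟨ cong (x ∷_) (≡.sym (List.map-∘ (upTo n))) ⟩
  x ∷ map ((l !_) ∘ suc) (upTo n)                         ≡⟨ cong (x ∷_) (List.map-∘ (upTo n)) ⟩
  x ∷ map (l !_) (range1 n)                               ≡⟨ cong (x ∷_) (map-! l) ⟩
  x ∷ l ∎
  where
  open ≡.≡-Reasoning
  n = length l

!-map : ∀ (f : ℕ → ℕ) {n v} → v ∈ range1 n → map f (range1 n) ! v ≡ f v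
!-map f {n} {v} v∈ with ∈-map⁻ suc v∈
... | i , i∈ , ≡.refl = go f n i (∈-upTo⁻ i∈)
  where
  go : ∀ f n i → i < n → map f (range1 n) ! suc i ≡ f (suc i)
  go f (suc n) zero    _         = ≡.refl
  go f (suc n) (suc i) (s≤s i<n) = begin
    map f (range1 (suc n)) ! suc (suc i)             ≡⟨ cong (λ l → map f l ! suc (suc i)) (range1-suc n) ⟩
    map f (map suc (range1 n)) ! suc i               ≡⟨ cong (_! suc i) (≡.sym (List.map-∘ (range1 n))) ⟩
    map (f ∘ suc) (range1 n) ! suc i                 ≡⟨ go (f ∘ suc) n i i<n ⟩
    f (suc (suc i))                                  ∎
    where open ≡.≡-Reasoning

!-∈ : ∀ {l v} → v ∈ range1 (length l) → l ! v ∈ l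
!-∈ {l} {v} v∈ = ≡.subst (l ! v ∈_) (map-! l) (∈-map⁺ (l !_) v∈)

-- That positions lie in range, that `inverse` yields a permutation and that `indexOf` undoes `!`
-- are all read off from this one equation of lists.
map-indexOf : ∀ {l} → Unique l → map (λ v → indexOf v l) l ≡ range1 (length l)
map-indexOf []                  = ≡.refl
map-indexOf {x ∷ l} (x∉l ∷ l!) = begin
  map (λ v → indexOf v (x ∷ l)) (x ∷ l)          ≡⟨ cong₂ _∷_ first (List.map-cong-local rest) ⟩
  1 ∷ map (λ v → suc (indexOf v l)) l            ≡⟨ cong (1 ∷_) (List.map-∘ l) ⟩
  1 ∷ map suc (map (λ v → indexOf v l) l)        ≡⟨ cong (λ k → 1 ∷ map suc k) (map-indexOf l!) ⟩
  1 ∷ map suc (range1 (length l))                ≡⟨ ≡.sym (range1-suc (length l)) ⟩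
  range1 (length (x ∷ l))                        ∎
  where
  open ≡.≡-Reasoning
  first : indexOf x (x ∷ l) ≡ 1
  first rewrite T-≡ᵇ {x} ≡.refl = ≡.refl
  rest : All (λ v → indexOf v (x ∷ l) ≡ suc (indexOf v l)) l
  rest = All.map (λ {v} x≢v → cong (if_then 1 else suc (indexOf v l)) (≢⇒≡ᵇ-false (x≢v ∘ ≡.sym))) x∉l

!-indexOf : ∀ {v l} → v ∈ l → l ! indexOf v l ≡ v
!-indexOf {v} {x ∷ l} v∈ with v ℕ.≟ x
... | yes ≡.refl rewrite T-≡ᵇ {x} ≡.refl = ≡.refl
!-indexOf {v} {x ∷ l} (here v≡x) | no v≢x = contradiction v≡x v≢x
!-indexOf {v} {x ∷ l} (there v∈) | no v≢x rewrite ≢⇒≡ᵇ-false v≢x = ≡.trans (shift (indexOf-pos v∈)) (!-indexOf v∈)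
  where
  indexOf-pos : ∀ {v l} → v ∈ l → Σ[ i ∈ ℕ ] indexOf v l ≡ suc i
  indexOf-pos {v} {y ∷ l} _ with v ≡ᵇ y
  ... | true  = 0 , ≡.refl
  ... | false = _ , ≡.refl
  shift : ∀ {k} → Σ[ i ∈ ℕ ] k ≡ suc i → (x ∷ l) ! suc k ≡ l ! k
  shift (i , ≡.refl) = ≡.refl

indexOf-! : ∀ {l v} → Unique l → v ∈ range1 (length l) → indexOf (l ! v) l ≡ v
indexOf-! {l} {v} l! v∈ = begin
  indexOf (l ! v) l                                            ≡⟨ ≡.sym (!-map (λ v → indexOf (l ! v) l) v∈) ⟩
  map (λ v → indexOf (l ! v) l) (range1 (length l)) ! v        ≡⟨ cong (_! v) (List.map-∘ (range1 (length l))) ⟩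
  map (λ v → indexOf v l) (map (l !_) (range1 (length l))) ! v ≡⟨ cong (λ k → map (λ v → indexOf v l) k ! v) (map-! l) ⟩
  map (λ v → indexOf v l) l ! v                                ≡⟨ cong (_! v) (map-indexOf l!) ⟩
  range1 (length l) ! v                                        ≡⟨ cong (_! v) (≡.sym (List.map-id (range1 (length l)))) ⟩
  map (λ v → v) (range1 (length l)) ! v                        ≡⟨ !-map (λ v → v) v∈ ⟩
  v                                                            ∎
  where open ≡.≡-Reasoning

indexOf-∈ : ∀ {l v} → Unique l → v ∈ l → indexOf v l ∈ range1 (length l)
indexOf-∈ {l} {v} l! v∈ = ≡.subst (indexOf v l ∈_) (map-indexOf l!) (∈-map⁺ (λ v → indexOf v l) v∈)

module _ {n σ} (σ↭ : σ ↭ range1 n) where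
  perm-length : length σ ≡ n
  perm-length = ≡.trans (Perm.↭-length σ↭) (length-range1 n)

  perm-unique : Unique σ
  perm-unique = unique-resp-↭ (↭-sym σ↭) (range1-unique n)

  inverse-↭ : inverse σ ↭ range1 n
  inverse-↭ = ↭-trans (Perm.map⁺ (λ v → indexOf v σ) (↭-trans (↭-reflexive (cong range1 perm-length)) (↭-sym σ↭)))
    (↭-reflexive (≡.trans (map-indexOf perm-unique) (cong range1 perm-length)))

inverse-involutive : ∀ {n σ} → σ ↭ range1 n → inverse (inverse σ) ≡ σ
inverse-involutive {n} {σ} σ↭ = begin
  map (λ i → indexOf i τ) (range1 (length τ))  ≡⟨ cong (λ k → map (λ i → indexOf i τ) (range1 k)) lenτ ⟩
  map (λ i → indexOf i τ) (range1 (length σ))  ≡⟨ List.map-cong-local (All.tabulate pointwise) ⟩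
  map (σ !_) (range1 (length σ))               ≡⟨ map-! σ ⟩
  σ                                            ∎
  where
  open ≡.≡-Reasoning
  τ = inverse σ
  lenτ : length τ ≡ length σ
  lenτ = ≡.trans (perm-length (inverse-↭ σ↭)) (≡.sym (perm-length σ↭))
  pointwise : ∀ {i} → i ∈ range1 (length σ) → indexOf i τ ≡ σ ! i
  pointwise {i} i∈ = begin
    indexOf i τ             ≡⟨ cong (λ k → indexOf k τ) (≡.sym (≡.trans (!-map (λ v → indexOf v σ) σi∈) (indexOf-! (perm-unique σ↭) i∈))) ⟩
    indexOf (τ ! (σ ! i)) τ ≡⟨ indexOf-! (perm-unique (inverse-↭ σ↭)) (≡.subst (λ k → σ ! i ∈ range1 k) (≡.sym lenτ) σi∈) ⟩
    σ ! i                   ∎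
    where
    σi∈ : σ ! i ∈ range1 (length σ)
    σi∈ = ≡.subst (λ k → σ ! i ∈ range1 k) (≡.sym (perm-length σ↭)) (Perm.∈-resp-↭ σ↭ (!-∈ {σ} i∈))

-- Chains

-- All c with lo ≤ c₁ ≤ c₂ ≤ … < lo + b, of the length of τ and strictly increasing at its descents.
chains : ℕ → ℕ → List ℕ → List (List ℕ)
chains lo b       []      = [] ∷ []
chains lo zero    (x ∷ τ) = []
chains lo (suc b) (x ∷ τ) = chains (suc lo) b (x ∷ τ) ++ map (lo ∷_) (chains (lo ℕ.+ desAt x τ) (suc b ∸ desAt x τ) τ)

-- The recursion of `chains` counts down the number b of admissible values. Here only the fixed
-- bound `hi`, which equals `lo` + b, remains, and each letter hands its successor a lower bound,
-- raised by one at a descent.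
data Chain (hi : ℕ) : ℕ → List ℕ → List ℕ → Set where
  []   : ∀ {lo} → Chain hi lo [] []
  cons : ∀ {lo y c x τ} → lo ≤ y → y < hi → Chain hi (y ℕ.+ desAt x τ) c τ → Chain hi lo (y ∷ c) (x ∷ τ)

desAt≤1 : ∀ x τ → desAt x τ ≤ 1
desAt≤1 x []      = z≤n
desAt≤1 x (y ∷ τ) with y <ᵇ x
... | true  = s≤s z≤n
... | false = z≤n

bound-∷ : ∀ {lo b hi d} → d ≤ 1 → lo ℕ.+ suc b ≡ hi → (lo ℕ.+ d) ℕ.+ (suc b ∸ d) ≡ hi
bound-∷ {lo} {b} {hi} {d} d≤1 eq = ≡.trans (ℕ.+-assoc lo d (suc b ∸ d))
  (≡.trans (cong (lo ℕ.+_) (ℕ.m+[n∸m]≡n (ℕ.≤-trans d≤1 (s≤s z≤n)))) eq)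

private
  weaken : ∀ {hi lo lo′ c τ} → lo ≤ lo′ → Chain hi lo′ c τ → Chain hi lo c τ
  weaken lo≤lo′ []                 = []
  weaken lo≤lo′ (cons lo′≤y y<hi p) = cons (ℕ.≤-trans lo≤lo′ lo′≤y) y<hi p

∈-chains⁻ : ∀ {hi} lo b τ {c} → lo ℕ.+ b ≡ hi → c ∈ chains lo b τ → Chain hi lo c τ
∈-chains⁻ lo b       []      eq (here ≡.refl) = []
∈-chains⁻ lo (suc b) (x ∷ τ) eq c∈ with ∈-++⁻ (chains (suc lo) b (x ∷ τ)) c∈
... | inj₁ c∈′ = weaken (ℕ.n≤1+n lo) (∈-chains⁻ (suc lo) b (x ∷ τ) (≡.trans (≡.sym (ℕ.+-suc lo b)) eq) c∈′)
... | inj₂ c∈′ with ∈-map⁻ (lo ∷_) c∈′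
...   | c′ , c′∈ , ≡.refl = cons ℕ.≤-refl (≡.subst (lo <_) eq (ℕ.m<m+n lo (s≤s z≤n)))
  (∈-chains⁻ (lo ℕ.+ desAt x τ) (suc b ∸ desAt x τ) τ (bound-∷ {lo} {b} (desAt≤1 x τ) eq) c′∈)

∈-chains⁺ : ∀ {hi} lo b τ {c} → lo ℕ.+ b ≡ hi → Chain hi lo c τ → c ∈ chains lo b τ
∈-chains⁺ lo b       []      eq [] = here ≡.refl
∈-chains⁺ lo zero    (x ∷ τ) eq (cons lo≤y y<hi p) =
  contradiction (ℕ.<-≤-trans y<hi (≡.subst (_≤ _) (≡.trans (≡.sym (ℕ.+-identityʳ lo)) eq) lo≤y)) (ℕ.<-irrefl ≡.refl)
∈-chains⁺ lo (suc b) (x ∷ τ) eq (cons lo≤y y<hi p) =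
  [ (λ lo<y → ∈-++⁺ˡ (∈-chains⁺ (suc lo) b (x ∷ τ) (≡.trans (≡.sym (ℕ.+-suc lo b)) eq) (cons lo<y y<hi p)))
  , (λ { ≡.refl → ∈-++⁺ʳ (chains (suc lo) b (x ∷ τ)) (∈-map⁺ (lo ∷_)
         (∈-chains⁺ (lo ℕ.+ desAt x τ) (suc b ∸ desAt x τ) τ (bound-∷ {lo} {b} (desAt≤1 x τ) eq) p)) })
  ]′ (ℕ.m≤n⇒m<n∨m≡n lo≤y)

chains-unique : ∀ lo b τ → Unique (chains lo b τ)
chains-unique lo b       []      = [] ∷ []
chains-unique lo zero    (x ∷ τ) = []
chains-unique lo (suc b) (x ∷ τ) = Unique.++⁺ (chains-unique (suc lo) b (x ∷ τ))
  (Unique.map⁺ List.∷-injectiveʳ (chains-unique (lo ℕ.+ desAt x τ) (suc b ∸ desAt x τ) τ)) disjoint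
  where
  disjoint : ∀ {c} → c ∈ chains (suc lo) b (x ∷ τ) × c ∈ map (lo ∷_) (chains (lo ℕ.+ desAt x τ) (suc b ∸ desAt x τ) τ) → _
  disjoint (c∈ , c∈′) with ∈-map⁻ (lo ∷_) c∈′ | ∈-chains⁻ (suc lo) b (x ∷ τ) ≡.refl c∈
  ... | _ , _ , ≡.refl | cons lo<lo _ _ = ℕ.<-irrefl ≡.refl lo<lo

chain-length : ∀ {hi lo c τ} → Chain hi lo c τ → length c ≡ length τ
chain-length []          = ≡.refl
chain-length (cons _ _ p) = cong suc (chain-length p)

chain-bounds : ∀ {hi lo c τ} → Chain hi lo c τ → All (λ y → lo ≤ y × y < hi) c
chain-bounds []                 = []
chain-bounds (cons lo≤y y<hi p) =
  (lo≤y , y<hi) ∷ All.map (λ (le , lt) → ℕ.≤-trans lo≤y (ℕ.≤-trans (ℕ.m≤m+n _ _) le) , lt) (chain-bounds p)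

-- The lexicographic order on pairs of a letter and its position

infix 4 _≼_
_≼_ : ℕ × ℕ → ℕ × ℕ → Set
_≼_ = ×-Lex _≡_ _<_ _≤_

lexOrder : DecTotalOrder 0ℓ 0ℓ 0ℓ
lexOrder = record
  { Carrier = ℕ × ℕ
  ; _≈_     = _≡_
  ; _≤_     = _≼_
  ; isDecTotalOrder = record
    { isTotalOrder = record
      { isPartialOrder = record
        { isPreorder = record
          { isEquivalence = ≡.isEquivalence
          ; reflexive     = λ { ≡.refl → inj₂ (≡.refl , ℕ.≤-refl) }
          ; trans         = ×-transitive {_<₂_ = _≤_} ≡.isEquivalence ℕ.<-resp₂-≡ ℕ.<-trans ℕ.≤-trans
          }
        ; antisym = λ {p} {q} p≼q q≼p → antisym-≡ {p} {q}
            (×-antisymmetric {_<₂_ = _≤_} ≡.sym ℕ.<-irrefl ℕ.<-asym ℕ.≤-antisym {p} {q} p≼q q≼p)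
        }
      ; total = ×-total₂ ≡.sym ℕ.<-cmp ℕ.≤-total
      }
    ; _≟_  = ×-≡-dec ℕ._≟_ ℕ._≟_
    ; _≤?_ = ×-decidable ℕ._≟_ ℕ._<?_ ℕ._≤?_
    }
  }
  where
  antisym-≡ : ∀ {p q : ℕ × ℕ} → proj₁ p ≡ proj₁ q × proj₂ p ≡ proj₂ q → p ≡ q
  antisym-≡ (≡.refl , ≡.refl) = ≡.refl

open Sort lexOrder using (sort; sort-↭; sort-↗)

sorted-↭⇒≡ : ∀ {P Q} → Linked _≼_ P → Linked _≼_ Q → P ↭ Q → P ≡ Q
sorted-↭⇒≡ P↗ Q↗ P↭Q =
  PW.Pointwise-≡⇒≡ (↗↭↗⇒≋ (DecTotalOrder.totalOrder lexOrder) P↗ Q↗ (↭⇒↭ₛ P↭Q))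

-- The condition between neighbours of a chain is the lexicographic order of the pairs (letter,
-- position): where the positions descend the letters must grow strictly, elsewhere a tie is
-- allowed. `≼-desAt` is the converse.
desAt-≼ : ∀ {y y′ x x′ τ} → y ℕ.+ desAt x (x′ ∷ τ) ≤ y′ → (y , x) ≼ (y′ , x′)
desAt-≼ {y} {y′} {x} {x′} le with x′ ℕ.<? x
... | yes x′<x rewrite <ᵇ-true x′<x | ℕ.+-comm y 1 = inj₁ le
... | no x′≮x rewrite <ᵇ-false (ℕ.≮⇒≥ x′≮x) | ℕ.+-identityʳ y with ℕ.m≤n⇒m<n∨m≡n le
...   | inj₁ y<y′ = inj₁ y<y′
...   | inj₂ y≡y′ = inj₂ (y≡y′ , ℕ.≮⇒≥ x′≮x)

≼-desAt : ∀ {y y′ x x′} τ → (y , x) ≼ (y′ , x′) → y ℕ.+ desAt x (x′ ∷ τ) ≤ y′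
≼-desAt {y} {y′} {x} {x′} τ (inj₁ y<y′) =
  ℕ.≤-trans (ℕ.+-monoʳ-≤ y (desAt≤1 x (x′ ∷ τ))) (≡.subst (_≤ y′) (ℕ.+-comm 1 y) y<y′)
≼-desAt {y} τ (inj₂ (≡.refl , x≤x′)) rewrite <ᵇ-false x≤x′ = ℕ.≤-reflexive (ℕ.+-identityʳ y)

chain⇒sorted : ∀ {hi lo c τ} → Chain hi lo c τ → Linked _≼_ (zip c τ)
chain⇒sorted []                                  = []
chain⇒sorted (cons _ _ [])                       = [-]
chain⇒sorted (cons _ _ p@(cons {τ = τ} le _ _)) = desAt-≼ {τ = τ} le ∷ chain⇒sorted p

sorted⇒chain : ∀ {hi lo} P → Linked _≼_ P → All (λ p → lo ≤ proj₁ p × proj₁ p < hi) P → Chain hi lo (map proj₁ P) (map proj₂ P)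
sorted⇒chain []           _         _                = []
sorted⇒chain (p ∷ P) P↗ ((lo≤y , y<hi) ∷ bs) = go p P P↗ lo≤y y<hi bs
  where
  -- The lower bound of the tail comes from the order relation with its predecessor; `lo₀` in the
  -- list of bounds is therefore independent of `lo`.
  go : ∀ {hi lo lo₀} p P → Linked _≼_ (p ∷ P) → lo ≤ proj₁ p → proj₁ p < hi →
       All (λ p → lo₀ ≤ proj₁ p × proj₁ p < hi) P → Chain hi lo (map proj₁ (p ∷ P)) (map proj₂ (p ∷ P))
  go p []       _         lo≤y y<hi _               = cons lo≤y y<hi []
  go p (p′ ∷ P) (r ∷ P↗) lo≤y y<hi ((_ , y′<hi) ∷ bs) =
    cons lo≤y y<hi (go p′ P P↗ (≼-desAt (map proj₂ P) r) y′<hi bs)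

-- Words as permutations with a chain

zip-map : ∀ {B C D : Set} (f : B → C) (g : B → D) xs → zip (map f xs) (map g xs) ≡ map (λ x → f x , g x) xs
zip-map f g []       = ≡.refl
zip-map f g (x ∷ xs) = cong (_ ∷_) (zip-map f g xs)

map-proj₁-zip : ∀ {B C : Set} (xs : List B) (ys : List C) → length xs ≡ length ys → map proj₁ (zip xs ys) ≡ xs
map-proj₁-zip []       []       _  = ≡.refl
map-proj₁-zip (x ∷ xs) (y ∷ ys) eq = cong (x ∷_) (map-proj₁-zip xs ys (ℕ.suc-injective eq))

map-proj₂-zip : ∀ {B C : Set} (xs : List B) (ys : List C) → length xs ≡ length ys → map proj₂ (zip xs ys) ≡ ys
map-proj₂-zip []       []       _  = ≡.refl
map-proj₂-zip (x ∷ xs) (y ∷ ys) eq = cong (y ∷_) (map-proj₂-zip xs ys (ℕ.suc-injective eq))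

tagged : List ℕ → List (ℕ × ℕ)
tagged w = map (λ i → w ! i , i) (range1 (length w))

-- σ(i) is the rank of position i, and c lists the letters in weakly increasing order, so position i
-- receives the letter of rank σ(i).
apply : List ℕ × List ℕ → List ℕ
apply (σ , c) = map (c !_) σ

-- After sorting, the positions form the inverse of the standardization, hence the call of
-- `inverse`; the letters form its chain.
standardize : List ℕ → List ℕ × List ℕ
standardize w = inverse (map proj₂ (sort (tagged w))) , map proj₁ (sort (tagged w))

permChains : ℕ → ℕ → List (List ℕ × List ℕ)
permChains N n = concatMap (λ σ → map (σ ,_) (chains 1 N (inverse σ))) (perms n)

∈-permChains⁻ : ∀ {N n σ c} → (σ , c) ∈ permChains N n → σ ↭ range1 n × Chain (suc N) 1 c (inverse σ)
∈-permChains⁻ {N} {n} p∈ with find (∈-concatMap⁻ (λ σ → map (σ ,_) (chains 1 N (inverse σ))) p∈)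
... | σ , σ∈ , σc∈ with ∈-map⁻ (σ ,_) σc∈
...   | c , c∈ , ≡.refl = ∈-perms⁻ σ∈ , ∈-chains⁻ 1 N (inverse σ) ≡.refl c∈

∈-permChains⁺ : ∀ {N n σ c} → σ ↭ range1 n → Chain (suc N) 1 c (inverse σ) → (σ , c) ∈ permChains N n
∈-permChains⁺ {N} {σ = σ} σ↭ p = ∈-concatMap⁺ (λ σ → map (σ ,_) (chains 1 N (inverse σ)))
  (lose (∈-perms⁺ σ↭) (∈-map⁺ (σ ,_) (∈-chains⁺ 1 N (inverse σ) ≡.refl p)))

permChains-unique : ∀ N n → Unique (permChains N n)
permChains-unique N n = unique-concatMap (λ σ → map (σ ,_) (chains 1 N (inverse σ))) (perms-unique n)
  (λ σ → Unique.map⁺ (cong proj₂) (chains-unique 1 N (inverse σ))) sep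
  where
  sep : ∀ {σ σ′ p} → p ∈ map (σ ,_) (chains 1 N (inverse σ)) → p ∈ map (σ′ ,_) (chains 1 N (inverse σ′)) → σ ≡ σ′
  sep {σ} {σ′} p∈ p∈′ with ∈-map⁻ (σ ,_) p∈ | ∈-map⁻ (σ′ ,_) p∈′
  ... | _ , _ , ≡.refl | _ , _ , eq = cong proj₁ eq

module _ {N n σ c} (σ↭ : σ ↭ range1 n) (chain : Chain (suc N) 1 c (inverse σ)) where
  private
    τ = inverse σ
    key : ℕ → ℕ × ℕ
    key v = c ! v , indexOf v σ

    length-c : length c ≡ n
    length-c = ≡.trans (chain-length chain) (perm-length (inverse-↭ σ↭))

    map-c : map (c !_) (range1 n) ≡ c
    map-c = ≡.trans (cong (map (c !_) ∘ range1) (≡.sym length-c)) (map-! c)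

    zip-key : zip c τ ≡ map key (range1 n)
    zip-key = ≡.trans (cong₂ zip (≡.sym map-c) (cong (map (λ v → indexOf v σ) ∘ range1) (perm-length σ↭))) (zip-map _ _ (range1 n))

  apply-↭ : apply (σ , c) ↭ c
  apply-↭ = ↭-trans (Perm.map⁺ (c !_) σ↭) (↭-reflexive map-c)

  apply-∈ : apply (σ , c) ∈ words N n
  apply-∈ = ∈-words⁺ N n (≡.trans (List.length-map (c !_) σ) (perm-length σ↭))
    (Perm.All-resp-↭ (↭-sym apply-↭) (All.map in-range (chain-bounds chain)))
    where
    in-range : ∀ {y} → 1 ≤ y × y < suc N → y ∈ range1 N
    in-range (s≤s z≤n , s≤s y≤N) = ∈-range1⁺ y≤N

  tagged-apply : tagged (apply (σ , c)) ≡ map key σ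
  tagged-apply = begin
    map (λ i → w ! i , i) (range1 (length w))             ≡⟨ ≡.sym (zip-map (w !_) (λ i → i) (range1 (length w))) ⟩
    zip (map (w !_) (range1 (length w))) (map (λ i → i) (range1 (length w)))
      ≡⟨ cong₂ zip (map-! w) (≡.trans (List.map-id _) (cong range1 (List.length-map (c !_) σ))) ⟩
    zip w (range1 (length σ))                             ≡⟨ cong (zip w) (≡.sym (map-indexOf (perm-unique σ↭))) ⟩
    zip (map (c !_) σ) (map (λ v → indexOf v σ) σ)        ≡⟨ zip-map _ _ σ ⟩
    map key σ                                             ∎
    where
    open ≡.≡-Reasoning
    w = apply (σ , c)

  -- A sorted rearrangement is unique, and the chain condition says that `zip c τ` is sorted
  -- already.
  sort-tagged-apply : sort (tagged (apply (σ , c))) ≡ zip c τ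
  sort-tagged-apply = sorted-↭⇒≡ (sort-↗ _) (chain⇒sorted chain)
    (↭-trans (sort-↭ _) (↭-trans (↭-reflexive tagged-apply)
      (↭-trans (Perm.map⁺ key σ↭) (↭-reflexive (≡.sym zip-key)))))

  standardize-apply : standardize (apply (σ , c)) ≡ (σ , c)
  standardize-apply = ≡.trans (cong (λ P → inverse (map proj₂ P) , map proj₁ P) sort-tagged-apply)
    (cong₂ _,_ (≡.trans (cong inverse (map-proj₂-zip c τ (chain-length chain))) (inverse-involutive σ↭))
               (map-proj₁-zip c τ (chain-length chain)))

  -- Ties of letters are the issue. When b < a, the pair of b precedes that of a in the order
  -- although b stands further right in σ, so its letter is strictly smaller. When a < b, a tie is
  -- harmless, since both comparisons are false anyway.
  apply-order : AllPairs (λ a b → (b <ᵇ a) ≡ (c ! b <ᵇ c ! a)) σ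
  apply-order = AllPairs-∈ compare (AllPairs.map⁻ (≡.subst (AllPairs _<_) (≡.sym (map-indexOf (perm-unique σ↭))) (range1-< (length σ))))
    where
    AllPairs-∈ : ∀ {R S : ℕ → ℕ → Set} {l} → (∀ {a b} → a ∈ l → b ∈ l → R a b → S a b) → AllPairs R l → AllPairs S l
    AllPairs-∈ f []       = []
    AllPairs-∈ f (r ∷ rs) = All.tabulate (λ b∈ → f (here ≡.refl) (there b∈) (All.lookup r b∈))
                            ∷ AllPairs-∈ (λ a∈ b∈ → f (there a∈) (there b∈)) rs
    lookup-< : ∀ {R : ℕ → ℕ → Set} {l a b} → AllPairs R l → AllPairs _<_ l → a ∈ l → b ∈ l → a < b → R a b
    lookup-< _        _        (here ≡.refl) (here ≡.refl) a<b = contradiction a<b (ℕ.<-irrefl ≡.refl)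
    lookup-< (r ∷ _)  _        (here ≡.refl) (there b∈)  a<b = All.lookup r b∈
    lookup-< _        (lt ∷ _) (there a∈)  (here ≡.refl) a<b = contradiction a<b (ℕ.<-asym (All.lookup lt a∈))
    lookup-< (_ ∷ rs) (_ ∷ ls) (there a∈)  (there b∈)  a<b = lookup-< rs ls a∈ b∈ a<b
    sorted : ∀ {a b} → a ∈ σ → b ∈ σ → a < b → key a ≼ key b
    sorted a∈ b∈ = lookup-<
      (AllPairs.map⁻ (Linked.Linked⇒AllPairs (DecTotalOrder.trans lexOrder) (≡.subst (Linked _≼_) zip-key (chain⇒sorted chain))))
      (range1-< n) (Perm.∈-resp-↭ σ↭ a∈) (Perm.∈-resp-↭ σ↭ b∈)
    compare : ∀ {a b} → a ∈ σ → b ∈ σ → indexOf a σ < indexOf b σ → (b <ᵇ a) ≡ (c ! b <ᵇ c ! a)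
    compare {a} {b} a∈ b∈ i<j with ℕ.<-cmp a b
    ... | tri≈ _ ≡.refl _ = contradiction i<j (ℕ.<-irrefl ≡.refl)
    ... | tri< a<b _ _  = ≡.trans (<ᵇ-false (ℕ.<⇒≤ a<b)) (≡.sym (<ᵇ-false (first (sorted a∈ b∈ a<b))))
      where
      first : key a ≼ key b → c ! a ≤ c ! b
      first (inj₁ lt)       = ℕ.<⇒≤ lt
      first (inj₂ (eq , _)) = ℕ.≤-reflexive eq
    ... | tri> _ _ b<a  = ≡.trans (<ᵇ-true b<a) (≡.sym (<ᵇ-true (first (sorted b∈ a∈ b<a))))
      where
      first : key b ≼ key a → c ! b < c ! a
      first (inj₁ lt)       = lt
      first (inj₂ (_ , le)) = contradiction i<j (ℕ.≤⇒≯ le)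

module _ {N n w} (w∈ : w ∈ words N n) where
  private
    P = sort (tagged w)
    τ = map proj₂ P
    c = map proj₁ P
    w-length = proj₁ (∈-words⁻ N n w∈)

    τ↭ : τ ↭ range1 n
    τ↭ = ↭-trans (Perm.map⁺ proj₂ (sort-↭ (tagged w)))
      (↭-reflexive (≡.trans (≡.sym (List.map-∘ (range1 (length w)))) (≡.trans (List.map-id _) (cong range1 w-length))))

    bounds : All (λ p → 1 ≤ proj₁ p × proj₁ p < suc N) P
    bounds = Perm.All-resp-↭ (↭-sym (sort-↭ (tagged w))) (All.map⁺ (All.tabulate bound))
      where
      bound : ∀ {i} → i ∈ range1 (length w) → 1 ≤ w ! i × w ! i < suc N
      bound {i} i∈ with ∈-range1⁻ (All.lookup (proj₂ (∈-words⁻ N n w∈)) (!-∈ {w} i∈))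
      ... | 1≤ , ≤N = 1≤ , s≤s ≤N

    ττ : inverse (inverse τ) ≡ τ
    ττ = inverse-involutive τ↭

  standardize-∈ : standardize w ∈ permChains N n
  standardize-∈ = ∈-permChains⁺ (inverse-↭ τ↭)
    (≡.subst (Chain (suc N) 1 c) (≡.sym ττ) (sorted⇒chain P (sort-↗ (tagged w)) bounds))

  apply-standardize : apply (standardize w) ≡ w
  apply-standardize = begin
    map (c !_) (map (λ i → indexOf i τ) (range1 (length τ)))  ≡⟨ ≡.sym (List.map-∘ (range1 (length τ))) ⟩
    map (λ i → c ! indexOf i τ) (range1 (length τ))           ≡⟨ List.map-cong-local (All.tabulate pointwise) ⟩
    map (w !_) (range1 (length τ))                            ≡⟨ cong (map (w !_) ∘ range1) (≡.trans (perm-length τ↭) (≡.sym w-length)) ⟩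
    map (w !_) (range1 (length w))                            ≡⟨ map-! w ⟩
    w                                                         ∎
    where
    open ≡.≡-Reasoning
    length-P : length τ ≡ length P
    length-P = List.length-map proj₂ P
    P-pairs : P ≡ map (λ v → c ! v , τ ! v) (range1 (length P))
    P-pairs = begin
      P                                                            ≡⟨ zip-proj P ⟩
      zip c τ                                                      ≡⟨ cong₂ zip (≡.sym (map-! c)) (≡.sym (map-! τ)) ⟩
      zip (map (c !_) (range1 (length c))) (map (τ !_) (range1 (length τ)))
        ≡⟨ cong₂ (λ k l → zip (map (c !_) (range1 k)) (map (τ !_) (range1 l))) (List.length-map proj₁ P) length-P ⟩
      zip (map (c !_) (range1 (length P))) (map (τ !_) (range1 (length P))) ≡⟨ zip-map _ _ (range1 (length P)) ⟩
      map (λ v → c ! v , τ ! v) (range1 (length P))                ∎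
      where
      zip-proj : ∀ (P : List (ℕ × ℕ)) → P ≡ zip (map proj₁ P) (map proj₂ P)
      zip-proj []      = ≡.refl
      zip-proj (p ∷ P) = cong (p ∷_) (zip-proj P)
    pair-∈ : ∀ {v} → v ∈ range1 (length τ) → (c ! v , τ ! v) ∈ P
    pair-∈ {v} v∈ = ≡.subst ((c ! v , τ ! v) ∈_) (≡.sym P-pairs)
      (∈-map⁺ (λ v → c ! v , τ ! v) (≡.subst (λ k → v ∈ range1 k) length-P v∈))
    tagged-∈ : ∀ {y i} → (y , i) ∈ tagged w → y ≡ w ! i
    tagged-∈ p∈ with ∈-map⁻ (λ i → w ! i , i) p∈
    ... | _ , _ , ≡.refl = ≡.refl
    pointwise : ∀ {i} → i ∈ range1 (length τ) → c ! indexOf i τ ≡ w ! i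
    pointwise {i} i∈ = tagged-∈ (Perm.∈-resp-↭ (sort-↭ (tagged w))
      (≡.subst (λ k → (c ! indexOf i τ , k) ∈ P) (!-indexOf i∈τ) (pair-∈ (indexOf-∈ (perm-unique τ↭) i∈τ))))
      where
      i∈τ : i ∈ τ
      i∈τ = Perm.∈-resp-↭ (↭-sym τ↭) (≡.subst (λ k → i ∈ range1 k) (perm-length τ↭) i∈)

permChains-↭ : ∀ N n → map apply (permChains N n) ↭ words N n
permChains-↭ N n = bijection⇒↭ apply standardize (permChains-unique N n) (words-unique N n)
  (λ p∈ → let σ↭ , chain = ∈-permChains⁻ {N} {n} p∈ in apply-∈ {N} {n} σ↭ chain)
  (λ p∈ → let σ↭ , chain = ∈-permChains⁻ {N} {n} p∈ in standardize-apply {N} {n} σ↭ chain)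
  (standardize-∈ {N} {n}) (apply-standardize {N} {n})

revℕ≡reverse : ∀ l → revℕ l ≡ reverse l
revℕ≡reverse []      = ≡.refl
revℕ≡reverse (x ∷ l) = ≡.trans (cong (_++ x ∷ []) (revℕ≡reverse l)) (≡.sym (List.unfold-reverse x l))

revℕ-↭ : ∀ l → revℕ l ↭ l
revℕ-↭ l = ↭-trans (↭-reflexive (revℕ≡reverse l)) (Perm.↭-reverse l)

-- The weight of a word is symmetric in its letters, so this allows the scan to run on the words
-- themselves instead of on their reversals.
words-reverse : ∀ N n → map revℕ (words N n) ↭ words N n
words-reverse N n = bijection⇒↭ revℕ revℕ (words-unique N n) (words-unique N n) closed (λ _ → involutive _) closed (λ _ → involutive _)
  where
  closed : ∀ {w} → w ∈ words N n → revℕ w ∈ words N n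
  closed {w} w∈ = let len , p = ∈-words⁻ N n w∈ in
    ∈-words⁺ N n (≡.trans (Perm.↭-length (revℕ-↭ w)) len) (Perm.All-resp-↭ (↭-sym (revℕ-↭ w)) p)
  involutive : ∀ w → revℕ (revℕ w) ≡ w
  involutive w = ≡.trans (revℕ≡reverse (revℕ w)) (≡.trans (cong reverse (revℕ≡reverse w)) (List.reverse-involutive w))

-- Hook statistics only compare letters

module _ (φ : ℕ → ℕ) where
  private
    R : ℕ → ℕ → Set
    R a b = (b <ᵇ a) ≡ (φ b <ᵇ φ a)

  countLt-map : ∀ {x l} → All (R x) l → countLt (φ x) (map φ l) ≡ countLt x l
  countLt-map []      = ≡.refl
  countLt-map (r ∷ p) = cong₂ ℕ._+_ (cong b2n (≡.sym r)) (countLt-map p)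

  inv-map : ∀ {l} → AllPairs R l → inv (map φ l) ≡ inv l
  inv-map []       = ≡.refl
  inv-map (r ∷ rs) = cong₂ ℕ._+_ (countLt-map r) (inv-map rs)

  mutual
    hookRev-map : ∀ xs → AllPairs (flip R) xs → hookRev (map φ xs) ≡ hookRev xs
    hookRev-map []       _        = ≡.refl
    hookRev-map (y ∷ ys) (r ∷ rs) = hookStep-map (y ∷ []) y ys r (All.map (_∷ []) r) rs ([] ∷ [])

    hookStep-map : ∀ h z xs → All (λ x → R x z) xs → All (λ x → All (R x) h) xs → AllPairs (flip R) xs → AllPairs R h →
                   hookStep (map φ h) (φ z) (map φ xs) ≡ hookStep h z xs
    hookStep-map h z []       _         _         _        _  = cong (_, 0) (List.length-map φ h)
    hookStep-map h z (x ∷ xs) (rz ∷ rzs) (rh ∷ rhs) (r ∷ rs) hh with z <ᵇ x | φ z <ᵇ φ x | rz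
    ... | true  | true  | ≡.refl =
      cong₂ _,_ (cong proj₁ (hookRev-map xs rs)) (cong₂ ℕ._+_ (cong proj₂ (hookRev-map xs rs)) (inv-map (rh ∷ hh)))
    ... | false | false | ≡.refl =
      hookStep-map (x ∷ h) x xs r (All.zipWith (λ (p , ps) → p ∷ ps) (r , rhs)) rs (rh ∷ hh)

  map-revℕ : ∀ l → map φ (revℕ l) ≡ revℕ (map φ l)
  map-revℕ []      = ≡.refl
  map-revℕ (x ∷ l) = ≡.trans (List.map-++ φ (revℕ l) (x ∷ [])) (cong (_++ φ x ∷ []) (map-revℕ l))

  AllPairs-revℕ : ∀ {l} → AllPairs R l → AllPairs (flip R) (revℕ l)
  AllPairs-revℕ []                 = []
  AllPairs-revℕ {x ∷ l} (r ∷ rs) = AllPairs.++⁺ (AllPairs-revℕ rs) ([] ∷ [])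
    (All.map (_∷ []) (Perm.All-resp-↭ (↭-sym (revℕ-↭ l)) r))

hookRev-apply : ∀ {N n σ c} → σ ↭ range1 n → Chain (suc N) 1 c (inverse σ) →
                hookRev (revℕ (apply (σ , c))) ≡ hookRev (revℕ σ)
hookRev-apply {σ = σ} {c} σ↭ chain = ≡.trans (cong hookRev (≡.sym (map-revℕ (c !_) σ)))
  (hookRev-map (c !_) (revℕ σ) (AllPairs-revℕ (c !_) (apply-order σ↭ chain)))

-- Contraction, cancellation and infinite sums over the interface

module SeriesTheory (A : SeriesAlgebra) where
  open SeriesAlgebra A public
  open CommutativeRing commutativeRing hiding (zero) public
  open Exp commutativeSemiring public using (_^_; ^-homo-*; ^-distrib-*; ^-cong)
  open IntegerCoefficients commutativeRing public
  open SetoidReasoning setoid public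

  Raises : Carrier → Set
  Raises v = ∀ {k x y} → x ≈[ k ] y → v * x ≈[ suc k ] v * y

  Regular : Carrier → Set
  Regular d = ∀ {x y} → d * x ≈ d * y → x ≈ y

  ≈[]-refl : ∀ {k x} → x ≈[ k ] x
  ≈[]-refl = ≈⇒≈[] refl

  raises-*ˡ : ∀ {v} w → Raises v → Raises (v * w)
  raises-*ˡ {v} w raise {k} {x} {y} x≈y = ≈[]-trans (≈⇒≈[] (*-assoc v w x))
    (≈[]-trans (raise (≈[]-* ≈[]-refl x≈y)) (≈⇒≈[] (sym (*-assoc v w y))))

  -- Write x as (1 - v) x + v x. The first summands are equal, and agreement of x and y below k
  -- gives agreement of the second summands below k + 1.
  raises-regular : ∀ {v} → Raises v → Regular (1# - v)
  raises-regular {v} raise {x} {y} eq = ≈[]⇒≈ agree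
    where
    split : ∀ v x → x ≈ (1# - v) * x + v * x
    split = solve 2 (λ v x → x := (con 1ℤ :- v) :* x :+ v :* x) refl
    agree : ∀ k → x ≈[ k ] y
    agree zero    = ≈[]-zero
    agree (suc k) = ≈[]-trans (≈⇒≈[] (split v x))
      (≈[]-trans (≈[]-+ (≈⇒≈[] eq) (raise (agree k))) (≈⇒≈[] (sym (split v y))))

  regular-* : ∀ {d e} → Regular d → Regular e → Regular (d * e)
  regular-* {d} {e} rd re {x} {y} eq = re (rd (trans (sym (*-assoc d e x)) (trans eq (*-assoc d e y))))

  module GeneratingSum
    (v : Carrier) (sumᵥ : (ℕ → Carrier) → Carrier)
    (sumᵥ-cong : ∀ {F G} → (∀ n → F n ≈ G n) → sumᵥ F ≈ sumᵥ G)
    (unfold : ∀ F → sumᵥ F ≈ F 0 + v * sumᵥ (F ∘ suc))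
    (raise : Raises v) where

    -- The sum is known only through its unfolding, so linearity is proved degree by degree: the
    -- tails agree below k, and the factor v lifts this to k + 1.
    scale : ∀ x F → sumᵥ (λ n → x * F n) ≈ x * sumᵥ F
    scale x F = ≈[]⇒≈ (λ k → agree k F)
      where
      agree : ∀ k F → sumᵥ (λ n → x * F n) ≈[ k ] x * sumᵥ F
      agree zero    F = ≈[]-zero
      agree (suc k) F = ≈[]-trans (≈⇒≈[] (unfold _))
        (≈[]-trans (≈[]-+ ≈[]-refl (raise (agree k (F ∘ suc))))
        (≈⇒≈[] (trans (solve 4 (λ x a v b → x :* a :+ v :* (x :* b) := x :* (a :+ v :* b)) refl _ _ _ _)
                      (*-congˡ (sym (unfold F))))))

    add : ∀ F G → sumᵥ (λ n → F n + G n) ≈ sumᵥ F + sumᵥ G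
    add F G = ≈[]⇒≈ (λ k → agree k F G)
      where
      agree : ∀ k F G → sumᵥ (λ n → F n + G n) ≈[ k ] sumᵥ F + sumᵥ G
      agree zero    F G = ≈[]-zero
      agree (suc k) F G = ≈[]-trans (≈⇒≈[] (unfold _))
        (≈[]-trans (≈[]-+ ≈[]-refl (raise (agree k (F ∘ suc) (G ∘ suc))))
        (≈⇒≈[] (trans (solve 5 (λ a b v c d → (a :+ b) :+ v :* (c :+ d) := (a :+ v :* c) :+ (b :+ v :* d)) refl _ _ _ _ _)
                      (+-cong (sym (unfold F)) (sym (unfold G))))))

    null : sumᵥ (λ _ → 0#) ≈ 0#
    null = trans (sumᵥ-cong (λ _ → sym (zeroˡ 0#))) (trans (scale 0# (λ _ → 0#)) (zeroˡ _))

  module USum = GeneratingSum u usum* usum-cong usum-unfold raise-u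
  module TSum = GeneratingSum t tsum* tsum-cong tsum-unfold raise-t

  -- The geometric series 1/(1 - uy).
  geo : Carrier → Carrier
  geo y = usum* (y ^_)

  geo-unfold : ∀ y → geo y ≈ 1# + u * (y * geo y)
  geo-unfold y = trans (usum-unfold (y ^_)) (+-congˡ (*-congˡ (USum.scale y (y ^_))))

  -- Finite sums

  Σ : ∀ {B : Set} → List B → (B → Carrier) → Carrier
  Σ xs f = foldr (λ x acc → f x + acc) 0# xs

  module _ {B : Set} where
    Σ-cong : ∀ (xs : List B) {f g} → (∀ {x} → x ∈ xs → f x ≈ g x) → Σ xs f ≈ Σ xs g
    Σ-cong []       p = refl
    Σ-cong (x ∷ xs) p = +-cong (p (here ≡.refl)) (Σ-cong xs (p ∘ there))

    Σ-++ : ∀ (xs : List B) {ys} {f : B → Carrier} → Σ (xs ++ ys) f ≈ Σ xs f + Σ ys f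
    Σ-++ []       = sym (+-identityˡ _)
    Σ-++ (x ∷ xs) = trans (+-congˡ (Σ-++ xs)) (sym (+-assoc _ _ _))

    Σ-↭ : ∀ {xs ys : List B} (f : B → Carrier) → xs ↭ ys → Σ xs f ≈ Σ ys f
    Σ-↭ f Perm.refl         = refl
    Σ-↭ f (Perm.prep x p)   = +-congˡ (Σ-↭ f p)
    Σ-↭ f (Perm.swap x y p) = trans (+-congˡ (+-congˡ (Σ-↭ f p)))
      (solve 3 (λ a b c → a :+ (b :+ c) := b :+ (a :+ c)) refl _ _ _)
    Σ-↭ f (Perm.trans p p′) = trans (Σ-↭ f p) (Σ-↭ f p′)

    Σ-scale : ∀ c (xs : List B) (f : B → Carrier) → Σ xs (λ x → c * f x) ≈ c * Σ xs f
    Σ-scale c []       f = sym (zeroʳ c)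
    Σ-scale c (x ∷ xs) f = trans (+-congˡ (Σ-scale c xs f)) (sym (distribˡ _ _ _))

    Σ-add : ∀ (xs : List B) (f g : B → Carrier) → Σ xs (λ x → f x + g x) ≈ Σ xs f + Σ xs g
    Σ-add []       f g = sym (+-identityˡ _)
    Σ-add (x ∷ xs) f g = trans (+-congˡ (Σ-add xs f g))
      (solve 4 (λ a b c d → (a :+ b) :+ (c :+ d) := (a :+ c) :+ (b :+ d)) refl _ _ _ _)

    Σ-null : ∀ (xs : List B) → Σ xs (λ _ → 0#) ≈ 0#
    Σ-null []       = refl
    Σ-null (x ∷ xs) = trans (+-identityˡ _) (Σ-null xs)

    usum-Σ : ∀ (xs : List B) (F : B → ℕ → Carrier) → usum* (λ n → Σ xs (λ x → F x n)) ≈ Σ xs (λ x → usum* (F x))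
    usum-Σ []       F = USum.null
    usum-Σ (x ∷ xs) F = trans (USum.add _ _) (+-congˡ (usum-Σ xs F))

    tsum-Σ : ∀ (xs : List B) (F : B → ℕ → Carrier) → tsum* (λ n → Σ xs (λ x → F x n)) ≈ Σ xs (λ x → tsum* (F x))
    tsum-Σ []       F = TSum.null
    tsum-Σ (x ∷ xs) F = trans (TSum.add _ _) (+-congˡ (tsum-Σ xs F))

  module _ {B C : Set} where
    Σ-map : ∀ (g : B → C) (xs : List B) {f : C → Carrier} → Σ (map g xs) f ≈ Σ xs (f ∘ g)
    Σ-map g []       = refl
    Σ-map g (x ∷ xs) = +-congˡ (Σ-map g xs)

    Σ-concatMap : ∀ (g : B → List C) (xs : List B) {f : C → Carrier} → Σ (concatMap g xs) f ≈ Σ xs (λ x → Σ (g x) f)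
    Σ-concatMap g []       = refl
    Σ-concatMap g (x ∷ xs) = trans (Σ-++ (g x)) (+-congˡ (Σ-concatMap g xs))

    Σ-swap : ∀ (xs : List B) (ys : List C) (f : B → C → Carrier) →
             Σ xs (λ x → Σ ys (f x)) ≈ Σ ys (λ y → Σ xs (λ x → f x y))
    Σ-swap []       ys f = sym (Σ-null ys)
    Σ-swap (x ∷ xs) ys f = trans (+-congˡ (Σ-swap xs ys f)) (sym (Σ-add ys _ _))

  -- pochᵣ a n is (a;q)_n.
  pochᵣ : Carrier → ℕ → Carrier
  pochᵣ a zero    = 1#
  pochᵣ a (suc n) = pochᵣ a n * (1# - a * q ^ n)

  -- The Verfahren of MacMahon

  -- Σ q^(c₁ + … + c_k) over b > c₁ ≥ … ≥ c_k ≥ 0 with c_i > c_{i+1} at the descents of τ.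
  chainPoly : ℕ → List ℕ → Carrier
  chainPoly b       []      = 1#
  chainPoly zero    (x ∷ τ) = 0#
  chainPoly (suc b) (x ∷ τ) = chainPoly b (x ∷ τ) + q ^ b * chainPoly (suc b ∸ desAt x τ) τ

  private
    -- The generating function of `chainPoly` in t, taken at t q^i. The induction on τ needs every
    -- i: a first letter of maximal value r contributes q^r, which replaces t by tq in the rest.
    chainSum : ℕ → List ℕ → Carrier
    chainSum i τ = tsum* (λ r → (q ^ i) ^ r * chainPoly (suc r) τ)

    -- The term r = 0 vanishes, because a nonempty τ has no chain below 0; shifting the index then
    -- produces the factor.
    chainSum-shift : ∀ i x τ → tsum* (λ r → (q ^ i) ^ r * chainPoly r (x ∷ τ)) ≈ (t * q ^ i) * chainSum i (x ∷ τ)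
    chainSum-shift i x τ = begin
      tsum* (λ r → p ^ r * c r)               ≈⟨ tsum-unfold _ ⟩
      1# * 0# + t * tsum* (λ r → (p * p ^ r) * c (suc r))
        ≈⟨ +-cong (zeroʳ 1#) (*-congˡ (trans (tsum-cong (λ r → *-assoc p (p ^ r) (c (suc r)))) (TSum.scale p _))) ⟩
      0# + t * (p * chainSum i (x ∷ τ))       ≈⟨ solve 3 (λ t p c → con 0ℤ :+ t :* (p :* c) := (t :* p) :* c) refl _ _ _ ⟩
      (t * p) * chainSum i (x ∷ τ)            ∎
      where
      p = q ^ i
      c = λ r → chainPoly r (x ∷ τ)

    chainSum-desAt : ∀ i x τ → tsum* (λ r → (q ^ i) ^ r * chainPoly (suc r ∸ desAt x τ) τ) ≈ (t * q ^ i) ^ desAt x τ * chainSum i τ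
    chainSum-desAt i x [] = sym (*-identityˡ _)
    chainSum-desAt i x (y ∷ τ) with y <ᵇ x
    ... | true  = trans (chainSum-shift i y τ) (*-congʳ (sym (*-identityʳ _)))
    ... | false = sym (*-identityˡ _)

    -- Either the first letter stays below the maximal value r, which reproduces the same sum with a
    -- factor t q^i, or it equals r, which turns i into i + 1. A descent lowers the bound of the
    -- rest by one, at the price of one more factor t q^(i+1).
    chainSum-∷ : ∀ i x τ → (1# - t * q ^ i) * chainSum i (x ∷ τ) ≈ (t * q ^ suc i) ^ desAt x τ * chainSum (suc i) τ
    chainSum-∷ i x τ = begin
      (1# - t * p) * E                          ≈⟨ solve 2 (λ v E → (con 1ℤ :- v) :* E := E :- v :* E) refl _ _ ⟩
      E - (t * p) * E                           ≈⟨ +-congʳ split ⟩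
      ((t * p) * E + E′) - (t * p) * E          ≈⟨ solve 2 (λ a b → (a :+ b) :- a := b) refl _ _ ⟩
      E′                                        ≈⟨ chainSum-desAt (suc i) x τ ⟩
      (t * q ^ suc i) ^ desAt x τ * chainSum (suc i) τ ∎
      where
      p = q ^ i
      E = chainSum i (x ∷ τ)
      E′ = tsum* (λ r → (q ^ suc i) ^ r * chainPoly (suc r ∸ desAt x τ) τ)
      split : E ≈ (t * p) * E + E′
      split = begin
        E ≈⟨ tsum-cong (λ r → begin
               p ^ r * (chainPoly r (x ∷ τ) + q ^ r * d r)
                 ≈⟨ solve 4 (λ p c q d → p :* (c :+ q :* d) := p :* c :+ (q :* p) :* d) refl _ _ _ _ ⟩
               p ^ r * chainPoly r (x ∷ τ) + (q ^ r * p ^ r) * d r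
                 ≈⟨ +-congˡ (*-congʳ (sym (^-distrib-* q p r))) ⟩
               p ^ r * chainPoly r (x ∷ τ) + (q * p) ^ r * d r ∎) ⟩
        tsum* (λ r → p ^ r * chainPoly r (x ∷ τ) + (q * p) ^ r * d r) ≈⟨ TSum.add _ _ ⟩
        tsum* (λ r → p ^ r * chainPoly r (x ∷ τ)) + E′ ≈⟨ +-congʳ (chainSum-shift i x τ) ⟩
        (t * p) * E + E′ ∎
        where
        d = λ r → chainPoly (suc r ∸ desAt x τ) τ

    -- This is (t q^i; q)_n with the first factor split off, as the induction on τ requires; `pochᵣ`
    -- splits off the last.
    pochFrom : ℕ → ℕ → Carrier
    pochFrom i zero    = 1#
    pochFrom i (suc n) = (1# - t * q ^ i) * pochFrom (suc i) n

    pochFrom-snoc : ∀ i n → pochFrom i (suc n) ≈ pochFrom i n * (1# - t * q ^ (i ℕ.+ n))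
    pochFrom-snoc i zero rewrite ℕ.+-identityʳ i = *-comm _ _
    pochFrom-snoc i (suc n) rewrite ℕ.+-suc i n = trans (*-congˡ (pochFrom-snoc (suc i) n)) (sym (*-assoc _ _ _))

    pochFrom-0 : ∀ n → pochFrom 0 n ≈ pochᵣ t n
    pochFrom-0 zero    = refl
    pochFrom-0 (suc n) = trans (pochFrom-snoc 0 n) (*-congʳ (pochFrom-0 n))

    des-maj-∷ : ∀ i x τ → (t * q ^ i) ^ desAt x τ * (t ^ des τ * q ^ majFrom (suc i) τ) ≈ t ^ des (x ∷ τ) * q ^ majFrom i (x ∷ τ)
    des-maj-∷ i x [] = *-identityˡ _
    des-maj-∷ i x (y ∷ τ) with y <ᵇ x
    ... | true  = begin
      ((t * q ^ i) * 1#) * (t ^ d * q ^ m)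
        ≈⟨ solve 4 (λ t p td qm → ((t :* p) :* con 1ℤ) :* (td :* qm) := (t :* td) :* (p :* qm)) refl _ _ _ _ ⟩
      (t * t ^ d) * (q ^ i * q ^ m) ≈⟨ *-congˡ (^-homo-* q i m) ⟨
      (t * t ^ d) * q ^ (i ℕ.+ m)   ∎
      where
      d = des (y ∷ τ)
      m = majFrom (suc i) (y ∷ τ)
    ... | false = *-identityˡ _

    -- Each letter taken off τ uses up one factor of the product, and a descent at its place
    -- contributes t q^(i+1). As i grows along τ, these exponents become the descent positions.
    chainSum-maj : ∀ i τ → pochFrom i (suc (length τ)) * chainSum i τ ≈ t ^ des τ * q ^ majFrom (suc i) τ
    chainSum-maj i [] = begin
      ((1# - t * p) * 1#) * E         ≈⟨ solve 2 (λ v E → ((con 1ℤ :- v) :* con 1ℤ) :* E := E :- v :* E) refl _ _ ⟩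
      E - (t * p) * E                 ≈⟨ +-congʳ unfolded ⟩
      (1# + (t * p) * E) - (t * p) * E ≈⟨ solve 1 (λ a → (con 1ℤ :+ a) :- a := con 1ℤ :* con 1ℤ) refl _ ⟩
      1# * 1#                         ∎
      where
      p = q ^ i
      E = chainSum i []
      unfolded : E ≈ 1# + (t * p) * E
      unfolded = begin
        E                                                    ≈⟨ tsum-unfold _ ⟩
        1# * 1# + t * tsum* (λ r → (p * p ^ r) * 1#)
          ≈⟨ +-cong (*-identityʳ _) (*-congˡ (trans (tsum-cong (λ r → *-assoc p (p ^ r) 1#)) (TSum.scale p _))) ⟩
        1# + t * (p * E)                                     ≈⟨ +-congˡ (*-assoc _ _ _) ⟨
        1# + (t * p) * E                                     ∎
    chainSum-maj i (x ∷ τ) = begin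
      (a * P) * chainSum i (x ∷ τ)       ≈⟨ solve 3 (λ a P E → (a :* P) :* E := P :* (a :* E)) refl _ _ _ ⟩
      P * (a * chainSum i (x ∷ τ))       ≈⟨ *-congˡ (chainSum-∷ i x τ) ⟩
      P * (w * chainSum (suc i) τ)       ≈⟨ solve 3 (λ P w E → P :* (w :* E) := w :* (P :* E)) refl _ _ _ ⟩
      w * (P * chainSum (suc i) τ)       ≈⟨ *-congˡ (chainSum-maj (suc i) τ) ⟩
      w * (t ^ des τ * q ^ majFrom (suc (suc i)) τ) ≈⟨ des-maj-∷ (suc i) x τ ⟩
      t ^ des (x ∷ τ) * q ^ majFrom (suc i) (x ∷ τ) ∎
      where
      a = 1# - t * q ^ i
      P = pochFrom (suc i) (suc (length τ))
      w = (t * q ^ suc i) ^ desAt x τ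

  macMahon : ∀ τ → pochᵣ t (suc (length τ)) * tsum* (λ r → chainPoly (suc r) τ) ≈ t ^ des τ * q ^ majFrom 1 τ
  macMahon τ = trans (*-cong (sym (pochFrom-0 (suc (length τ)))) (tsum-cong (λ r → sym (1^-* r)))) (chainSum-maj 0 τ)
    where
    1^≈1 : ∀ r → 1# ^ r ≈ 1#
    1^≈1 zero    = refl
    1^≈1 (suc r) = trans (*-identityˡ _) (1^≈1 r)
    1^-* : ∀ r → 1# ^ r * chainPoly (suc r) τ ≈ chainPoly (suc r) τ
    1^-* r = trans (*-congʳ (1^≈1 r)) (*-identityˡ _)

-- Sums over words and over initial segments of the alphabet

module WordSums (A : SeriesAlgebra) where
  open SeriesTheory A

  Σ-words : ∀ N n (f : List ℕ → Carrier) →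
            Σ (words N (suc n)) f ≈ Σ (range1 N) (λ x → Σ (words N n) (λ w → f (x ∷ w)))
  Σ-words N n f = begin
    Σ (words N (suc n)) f                                       ≈⟨ Σ-concatMap _ (words N n) ⟩
    Σ (words N n) (λ w → Σ (map (_∷ w) (range1 N)) f)           ≈⟨ Σ-cong (words N n) (λ _ → Σ-map (_∷ _) (range1 N)) ⟩
    Σ (words N n) (λ w → Σ (range1 N) (λ x → f (x ∷ w)))        ≈⟨ Σ-swap (words N n) (range1 N) _ ⟩
    Σ (range1 N) (λ x → Σ (words N n) (λ w → f (x ∷ w)))        ∎

  sumUpTo : ℕ → (ℕ → Carrier) → Carrier
  sumUpTo zero    f = 0#
  sumUpTo (suc n) f = sumUpTo n f + f (suc n)

  Σ-range1 : ∀ n (f : ℕ → Carrier) → Σ (range1 n) f ≈ sumUpTo n f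
  Σ-range1 zero    f = refl
  Σ-range1 (suc n) f = begin
    Σ (range1 (suc n)) f                  ≈⟨ reflexive (cong (λ l → Σ l f) split) ⟩
    Σ (range1 n ++ suc n ∷ []) f          ≈⟨ Σ-++ (range1 n) ⟩
    Σ (range1 n) f + (f (suc n) + 0#)     ≈⟨ +-cong (Σ-range1 n f) (+-identityʳ _) ⟩
    sumUpTo n f + f (suc n)               ∎
    where
    split : range1 (suc n) ≡ range1 n ++ suc n ∷ []
    split = ≡.trans (cong (map suc) (≡.sym (List.upTo-∷ʳ n))) (List.map-++ suc (upTo n) (n ∷ []))

  sumUpTo-cong : ∀ n {f g} → (∀ x → x ≤ n → f x ≈ g x) → sumUpTo n f ≈ sumUpTo n g
  sumUpTo-cong zero    p = refl
  sumUpTo-cong (suc n) p = +-cong (sumUpTo-cong n (λ x x≤n → p x (ℕ.m≤n⇒m≤1+n x≤n))) (p (suc n) ℕ.≤-refl)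

  sumUpTo-≈[] : ∀ n {k f g} → (∀ x → x ≤ n → f x ≈[ k ] g x) → sumUpTo n f ≈[ k ] sumUpTo n g
  sumUpTo-≈[] zero    p = ≈[]-refl
  sumUpTo-≈[] (suc n) p = ≈[]-+ (sumUpTo-≈[] n (λ x x≤n → p x (ℕ.m≤n⇒m≤1+n x≤n))) (p (suc n) ℕ.≤-refl)

  sumUpTo-scale : ∀ n c f → sumUpTo n (λ x → c * f x) ≈ c * sumUpTo n f
  sumUpTo-scale zero    c f = sym (zeroʳ c)
  sumUpTo-scale (suc n) c f = trans (+-congʳ (sumUpTo-scale n c f)) (sym (distribˡ _ _ _))

  sumUpTo-add : ∀ n f g → sumUpTo n (λ x → f x + g x) ≈ sumUpTo n f + sumUpTo n g
  sumUpTo-add zero    f g = sym (+-identityˡ _)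
  sumUpTo-add (suc n) f g = trans (+-congʳ (sumUpTo-add n f g))
    (solve 4 (λ a b c d → (a :+ b) :+ (c :+ d) := (a :+ c) :+ (b :+ d)) refl _ _ _ _)

  sumUpTo-null : ∀ n → sumUpTo n (λ _ → 0#) ≈ 0#
  sumUpTo-null zero    = refl
  sumUpTo-null (suc n) = trans (+-identityʳ _) (sumUpTo-null n)

  sumUpTo-trunc : ∀ z n (f : ℕ → Carrier) → z ≤ n → sumUpTo n (λ x → if z <ᵇ x then 0# else f x) ≈ sumUpTo z f
  sumUpTo-trunc zero zero    f p = refl
  sumUpTo-trunc z    (suc n) f p with ℕ.m≤n⇒m<n∨m≡n p
  ... | inj₂ ≡.refl     = sumUpTo-cong (suc n) (λ x x≤z → reflexive (if-≮ᵇ x≤z))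
  ... | inj₁ z<n@(s≤s z≤n′) = trans (+-cong (sumUpTo-trunc z n f z≤n′) (reflexive (if-<ᵇ z<n))) (+-identityʳ _)

  sumUpTo-split : ∀ z n (f g : ℕ → Carrier) → z ≤ n →
    sumUpTo n (λ x → if z <ᵇ x then f x else g x) ≈ sumUpTo n (λ x → if z <ᵇ x then f x else 0#) + sumUpTo z g
  sumUpTo-split z n f g z≤n′ = begin
    sumUpTo n (λ x → if z <ᵇ x then f x else g x)
      ≈⟨ sumUpTo-cong n (λ x _ → split (z <ᵇ x)) ⟩
    sumUpTo n (λ x → (if z <ᵇ x then f x else 0#) + (if z <ᵇ x then 0# else g x))
      ≈⟨ sumUpTo-add n _ _ ⟩
    sumUpTo n (λ x → if z <ᵇ x then f x else 0#) + sumUpTo n (λ x → if z <ᵇ x then 0# else g x)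
      ≈⟨ +-congˡ (sumUpTo-trunc z n g z≤n′) ⟩
    sumUpTo n (λ x → if z <ᵇ x then f x else 0#) + sumUpTo z g ∎
    where
    split : ∀ b {a c} → (if b then a else c) ≈ (if b then a else 0#) + (if b then 0# else c)
    split true  = sym (+-identityʳ _)
    split false = sym (+-identityˡ _)

-- The generating function of words, obtained from the automaton

module HookSeries (A : SeriesAlgebra) (N : ℕ) where
  open SeriesTheory A
  open WordSums A

  e : ℕ → Carrier
  e x = q ^ (N ∸ x)

  weight : List ℕ → Carrier
  weight []      = 1#
  weight (x ∷ w) = e x * weight w

  stat : ℕ × ℕ → Carrier
  stat (p , l) = s ^ l * Y ^ p

  Ψₙ : ℕ → Carrier
  Ψₙ n = Σ (words N n) (λ w → weight w * stat (hookRev w))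

  Ψ : Carrier
  Ψ = usum* Ψₙ

  private
    Φₙ : ℕ → List ℕ → ℕ → Carrier
    Φₙ n h z = Σ (words N n) (λ w → weight w * stat (hookStep h z w))

    -- The series of all continuations, read from right to left, of a run h with first letter z.
    Φ : List ℕ → ℕ → Carrier
    Φ h z = usum* (λ n → Φₙ n h z)

    -- A letter above z closes a hook and restarts the scan; any other letter extends the run. The
    -- continuations are parameters, so that one formula serves the coefficients, the series and the
    -- closed form.
    next : Carrier → (List ℕ → ℕ → Carrier) → List ℕ → ℕ → ℕ → Carrier
    next ψ φ h z x = e x * (if z <ᵇ x then s ^ inv (x ∷ h) * ψ else φ (x ∷ h) x)

    stat-∷ : ∀ h z x w → stat (hookStep h z (x ∷ w)) ≈
             (if z <ᵇ x then s ^ inv (x ∷ h) * stat (hookRev w) else stat (hookStep (x ∷ h) x w))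
    stat-∷ h z x w rewrite hookStep-∷ h z x w with z <ᵇ x
    ... | false = refl
    ... | true  = trans (*-congʳ (^-homo-* s (proj₂ (hookRev w)) (inv (x ∷ h))))
      (solve 3 (λ a b c → (a :* b) :* c := b :* (a :* c)) refl _ _ _)

    Φₙ-suc : ∀ n h z → Φₙ (suc n) h z ≈ Σ (range1 N) (next (Ψₙ n) (Φₙ n) h z)
    Φₙ-suc n h z = trans (Σ-words N n _) (Σ-cong (range1 N) λ {x} _ → begin
      Σ (words N n) (λ w → (e x * weight w) * stat (hookStep h z (x ∷ w)))
        ≈⟨ Σ-cong (words N n) (λ {w} _ → trans (*-congˡ (stat-∷ h z x w)) (*-assoc _ _ _)) ⟩
      Σ (words N n) (λ w → e x * (weight w * (if z <ᵇ x then s ^ inv (x ∷ h) * stat (hookRev w) else stat (hookStep (x ∷ h) x w))))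
        ≈⟨ Σ-scale (e x) (words N n) _ ⟩
      e x * Σ (words N n) (λ w → weight w * (if z <ᵇ x then s ^ inv (x ∷ h) * stat (hookRev w) else stat (hookStep (x ∷ h) x w)))
        ≈⟨ *-congˡ (branch (z <ᵇ x) h x) ⟩
      next (Ψₙ n) (Φₙ n) h z x ∎)
      where
      branch : ∀ b h x →
        Σ (words N n) (λ w → weight w * (if b then s ^ inv (x ∷ h) * stat (hookRev w) else stat (hookStep (x ∷ h) x w)))
        ≈ (if b then s ^ inv (x ∷ h) * Ψₙ n else Φₙ n (x ∷ h) x)
      branch true  h x = trans
        (Σ-cong (words N n) (λ _ → solve 3 (λ a b c → a :* (b :* c) := b :* (a :* c)) refl _ _ _))
        (Σ-scale (s ^ inv (x ∷ h)) (words N n) _)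
      branch false h x = refl

    Φ-unfold : ∀ h z → Φ h z ≈ Y ^ length h + u * sumUpTo N (next Ψ Φ h z)
    Φ-unfold h z = begin
      Φ h z ≈⟨ usum-unfold _ ⟩
      Φₙ 0 h z + u * usum* (λ n → Φₙ (suc n) h z)
        ≈⟨ +-cong (solve 1 (λ y → con 1ℤ :* (con 1ℤ :* y) :+ con 0ℤ := y) refl _) (*-congˡ tail) ⟩
      Y ^ length h + u * sumUpTo N (next Ψ Φ h z) ∎
      where
      branch : ∀ b x → usum* (λ n → e x * (if b then s ^ inv (x ∷ h) * Ψₙ n else Φₙ n (x ∷ h) x))
                       ≈ e x * (if b then s ^ inv (x ∷ h) * Ψ else Φ (x ∷ h) x)
      branch true  x = trans (USum.scale (e x) _) (*-congˡ (USum.scale _ Ψₙ))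
      branch false x = USum.scale (e x) _
      tail : usum* (λ n → Φₙ (suc n) h z) ≈ sumUpTo N (next Ψ Φ h z)
      tail = begin
        usum* (λ n → Φₙ (suc n) h z)                                 ≈⟨ usum-cong (λ n → Φₙ-suc n h z) ⟩
        usum* (λ n → Σ (range1 N) (next (Ψₙ n) (Φₙ n) h z))          ≈⟨ usum-Σ (range1 N) (λ x n → next (Ψₙ n) (Φₙ n) h z x) ⟩
        Σ (range1 N) (λ x → usum* (λ n → next (Ψₙ n) (Φₙ n) h z x))  ≈⟨ Σ-cong (range1 N) (λ {x} _ → branch (z <ᵇ x) x) ⟩
        Σ (range1 N) (next Ψ Φ h z)                                  ≈⟨ Σ-range1 N _ ⟩
        sumUpTo N (next Ψ Φ h z)                                     ∎

    Ψ≈Φ : Ψ ≈ Φ [] N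
    Ψ≈Φ = usum-cong (λ n → Σ-cong (words N n) (λ {w} w∈ →
      *-congˡ (reflexive (cong stat (≡.sym (hookStep-initial N w (words-≤ {N} {n} w∈)))))))

  -- geoProd a p m = Π_{i<m} 1/(1 - u a q^(p-1-i))
  geoProd : Carrier → ℕ → ℕ → Carrier
  geoProd a p zero    = 1#
  geoProd a p (suc m) = geoProd a p m * geo (a * q ^ (p ∸ suc m))

  private
    -- Enumerates the weakly increasing words over the letters at most z, with a marking every
    -- letter.
    I : Carrier → ℕ → Carrier
    I a = geoProd a N

    I-unfold : ∀ a z → I a (suc z) ≈ I a z + u * (e (suc z) * (a * I a (suc z)))
    I-unfold a z = begin
      I a z * g ≈⟨ *-congˡ (geo-unfold _) ⟩
      I a z * (1# + u * ((a * e (suc z)) * g))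
        ≈⟨ solve 5 (λ I u a e g → I :* (con 1ℤ :+ u :* ((a :* e) :* g)) := I :+ u :* (e :* (a :* (I :* g)))) refl _ _ _ _ _ ⟩
      I a z + u * (e (suc z) * (a * (I a z * g))) ∎
      where g = geo (a * e (suc z))

    I-telescope : ∀ a z → I a z ≈ 1# + sumUpTo z (λ x → u * (e x * (a * I a x)))
    I-telescope a zero    = sym (+-identityʳ _)
    I-telescope a (suc z) = trans (I-unfold a z) (trans (+-congʳ (I-telescope a z)) (+-assoc _ _ _))

    -- L z enumerates the hooks with letters at most z.
    L : ℕ → Carrier
    L zero    = 0#
    L (suc z) = geo (e (suc z)) * (u * (e (suc z) * (I s z - 1#)) + L z)

    -- In a hook over the letters at most z + 1, either z + 1 comes first and is followed by a
    -- nonempty run of smaller letters, each making one inversion; or z + 1 does not occur; or it is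
    -- the last letter, takes part in no inversion and can be removed.
    L-unfold : ∀ z → L (suc z) ≈ u * (e (suc z) * (I s z - 1#)) + L z + u * (e (suc z) * L (suc z))
    L-unfold z = begin
      g * m                         ≈⟨ *-congʳ (geo-unfold _) ⟩
      (1# + u * (e (suc z) * g)) * m ≈⟨ solve 4 (λ u e g m → (con 1ℤ :+ u :* (e :* g)) :* m := m :+ u :* (e :* (g :* m))) refl _ _ _ _ ⟩
      m + u * (e (suc z) * (g * m)) ∎
      where
      g = geo (e (suc z))
      m = u * (e (suc z) * (I s z - 1#)) + L z

    E : ℕ → Carrier
    E z = sumUpTo z (λ x → u * e x)

    -- α is the contribution of the letters above z.
    L-telescope : ∀ z α → α * I s z + L z ≈
      α + sumUpTo z (λ x → u * (e x * (s * (α + E z - E x) * I s x + L x)))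
    L-telescope zero    α = solve 1 (λ α → α :* con 1ℤ :+ con 0ℤ := α :+ con 0ℤ) refl _
    L-telescope (suc z) α = begin
      α * I s (suc z) + L (suc z)
        ≈⟨ +-cong (*-congˡ (I-unfold s z)) (L-unfold z) ⟩
      α * (I s z + u * (e′ * (s * I s (suc z)))) + (u * (e′ * (I s z - 1#)) + L z + u * (e′ * L (suc z)))
        ≈⟨ solve 8 (λ α Iz u e s I′ Lz L′ →
             α :* (Iz :+ u :* (e :* (s :* I′))) :+ (u :* (e :* (Iz :- con 1ℤ)) :+ Lz :+ u :* (e :* L′)) :=
             ((α :+ u :* e) :* Iz :+ Lz) :+ (:- (u :* e) :+ u :* (e :* (s :* α :* I′ :+ L′))))
             refl _ _ _ _ _ _ _ _ ⟩
      ((α + u * e′) * I s z + L z) + (- (u * e′) + u * (e′ * (s * α * I s (suc z) + L (suc z))))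
        -- Seen from the letters at most z, the letter z + 1 is one more letter above, so its weight
        -- joins α.
        ≈⟨ +-congʳ (L-telescope z (α + u * e′)) ⟩
      (α + u * e′ + sumUpTo z (λ x → u * (e x * (s * (α + u * e′ + E z - E x) * I s x + L x))))
        + (- (u * e′) + u * (e′ * (s * α * I s (suc z) + L (suc z))))
        ≈⟨ solve 4 (λ α ue S l → (α :+ ue :+ S) :+ (:- ue :+ l) := α :+ (S :+ l)) refl _ _ _ _ ⟩
      α + (sumUpTo z (λ x → u * (e x * (s * (α + u * e′ + E z - E x) * I s x + L x)))
        + u * (e′ * (s * α * I s (suc z) + L (suc z))))
        ≈⟨ +-congˡ (+-cong
             (sumUpTo-cong z (λ x _ → *-congˡ (*-congˡ (+-congʳ (*-congʳ (*-congˡ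
               (+-congʳ (solve 3 (λ α ue E → α :+ ue :+ E := α :+ (E :+ ue)) refl _ _ _))))))))
             (*-congˡ (*-congˡ (+-congʳ (*-congʳ (*-congˡ
               (solve 2 (λ α E → α := α :+ E :- E) refl _ _))))))) ⟩
      α + sumUpTo (suc z) (λ x → u * (e x * (s * (α + E (suc z) - E x) * I s x + L x))) ∎
      where e′ = e (suc z)

    -- The letters above z that turn the run h into a hook.
    A> : List ℕ → ℕ → Carrier
    A> h z = sumUpTo N (λ x → if z <ᵇ x then u * (e x * s ^ countLt x h) else 0#)

    -- Every letter above x makes exactly one inversion with the new letter x.
    A>-∷ : ∀ h x → A> (x ∷ h) x ≈ s * A> h x
    A>-∷ h x = trans (sumUpTo-cong N (λ y _ → termwise y)) (sumUpTo-scale N s _)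
      where
      termwise : ∀ y → (if x <ᵇ y then u * (e y * s ^ countLt y (x ∷ h)) else 0#) ≈
                       s * (if x <ᵇ y then u * (e y * s ^ countLt y h) else 0#)
      termwise y with x <ᵇ y
      ... | true  = solve 4 (λ u e s c → u :* (e :* (s :* c)) := s :* (u :* (e :* c))) refl _ _ _ _
      ... | false = sym (zeroʳ s)

    -- A letter at most z exceeds no letter of the run and carries s^0. The right-hand side does not
    -- involve z, which allows `A>-run` to move the boundary from z down to x.
    A>-total : ∀ {h z} → All (z ≤_) h → z ≤ N → A> h z + E z ≈ sumUpTo N (λ x → u * (e x * s ^ countLt x h))
    A>-total {h} {z} z≤h z≤N = sym (begin
      sumUpTo N (λ x → u * (e x * s ^ countLt x h))
        ≈⟨ sumUpTo-cong N (λ x _ → termwise x) ⟩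
      sumUpTo N (λ x → if z <ᵇ x then u * (e x * s ^ countLt x h) else u * e x)
        ≈⟨ sumUpTo-split z N _ _ z≤N ⟩
      A> h z + E z ∎)
      where
      termwise : ∀ x → u * (e x * s ^ countLt x h) ≈ (if z <ᵇ x then u * (e x * s ^ countLt x h) else u * e x)
      termwise x with z ℕ.<? x
      ... | yes z<x rewrite <ᵇ-true z<x = refl
      ... | no z≮x rewrite <ᵇ-false (ℕ.≮⇒≥ z≮x)
                         | countLt-≤ x h (All.map (ℕ.≤-trans (ℕ.≮⇒≥ z≮x)) z≤h) = *-congˡ (*-identityʳ _)

    -- A run can end in three ways. At the left end of the word, it and its extension are the
    -- increasing prefix: `I Y z`. A letter above z closes it, making one inversion with each letter
    -- of the extension: `A> h z * I s z`. A letter at most z closes it, and then all inversions lie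
    -- within the extension: `L z`. After a closed hook the scan restarts, hence the factor `Ψ`.
    Φ′ : List ℕ → ℕ → Carrier
    Φ′ h z = Y ^ length h * I Y z + Ψ * (A> h z * I s z + L z)

    -- The invariant of the scan: `sorted` reduces `inv (x ∷ h)` to `countLt x h`, and `lower` with
    -- `bound` makes `A>-total` applicable.
    record Run (h : List ℕ) (z : ℕ) : Set where
      field
        lower  : All (z ≤_) h
        sorted : inv h ≡ 0
        bound  : z ≤ N

    run-∷ : ∀ {h z x} → Run h z → x ≤ z → Run (x ∷ h) x
    run-∷ {h} {z} {x} r x≤z = record
      { lower  = ℕ.≤-refl ∷ x≤h
      ; sorted = cong₂ ℕ._+_ (countLt-≤ x h x≤h) (Run.sorted r)
      ; bound  = ℕ.≤-trans x≤z (Run.bound r)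
      }
      where x≤h = All.map (ℕ.≤-trans x≤z) (Run.lower r)

    -- Splitting the letters at z, those above give `Ψ * A> h z`; those at most z are summed by the
    -- telescoping identities for `I Y` and `L`, the latter with α = `A> h z`.
    Φ′-unfold : ∀ {h z} → Run h z → Φ′ h z ≈ Y ^ length h + u * sumUpTo N (next Ψ Φ′ h z)
    Φ′-unfold {h} {z} r = sym (begin
      yₕ + u * sumUpTo N (next Ψ Φ′ h z)
        ≈⟨ +-congˡ (*-congˡ (sumUpTo-cong N (λ x _ → branch (z <ᵇ x) x))) ⟩
      yₕ + u * sumUpTo N (λ x → if z <ᵇ x then e x * (s ^ inv (x ∷ h) * Ψ) else e x * Φ′ (x ∷ h) x)
        ≈⟨ +-congˡ (*-congˡ (sumUpTo-split z N _ _ bound)) ⟩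
      yₕ + u * (sumUpTo N (λ x → if z <ᵇ x then e x * (s ^ inv (x ∷ h) * Ψ) else 0#) + sumUpTo z (λ x → e x * Φ′ (x ∷ h) x))
        ≈⟨ +-congˡ (distribˡ _ _ _) ⟩
      yₕ + (u * sumUpTo N (λ x → if z <ᵇ x then e x * (s ^ inv (x ∷ h) * Ψ) else 0#) + u * sumUpTo z (λ x → e x * Φ′ (x ∷ h) x))
        ≈⟨ +-congˡ (+-cong finished continued) ⟩
      yₕ + (Ψ * A> h z + (yₕ * sumUpTo z fY + Ψ * sumUpTo z fL))
        ≈⟨ solve 5 (λ y ψ a f g → y :+ (ψ :* a :+ (y :* f :+ ψ :* g)) := y :* (con 1ℤ :+ f) :+ ψ :* (a :+ g)) refl _ _ _ _ _ ⟩
      yₕ * (1# + sumUpTo z fY) + Ψ * (A> h z + sumUpTo z fL)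
        ≈⟨ +-cong (*-congˡ (I-telescope Y z)) (*-congˡ (L-telescope z (A> h z))) ⟨
      Φ′ h z ∎)
      where
      open Run r
      yₕ = Y ^ length h
      fY fL : ℕ → Carrier
      fY x = u * (e x * (Y * I Y x))
      fL x = u * (e x * (s * (A> h z + E z - E x) * I s x + L x))
      branch : ∀ b x → e x * (if b then s ^ inv (x ∷ h) * Ψ else Φ′ (x ∷ h) x) ≈
                       (if b then e x * (s ^ inv (x ∷ h) * Ψ) else e x * Φ′ (x ∷ h) x)
      branch true  x = refl
      branch false x = refl
      finished : u * sumUpTo N (λ x → if z <ᵇ x then e x * (s ^ inv (x ∷ h) * Ψ) else 0#) ≈ Ψ * A> h z
      finished = trans (sym (sumUpTo-scale N u _)) (trans (sumUpTo-cong N (λ x _ → termwise x)) (sumUpTo-scale N Ψ _))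
        where
        termwise : ∀ x → u * (if z <ᵇ x then e x * (s ^ inv (x ∷ h) * Ψ) else 0#) ≈
                         Ψ * (if z <ᵇ x then u * (e x * s ^ countLt x h) else 0#)
        termwise x rewrite sorted | ℕ.+-identityʳ (countLt x h) with z <ᵇ x
        ... | true  = solve 4 (λ u e c ψ → u :* (e :* (c :* ψ)) := ψ :* (u :* (e :* c))) refl _ _ _ _
        ... | false = trans (zeroʳ u) (sym (zeroʳ Ψ))
      A>-run : ∀ {x} → x ≤ z → A> (x ∷ h) x ≈ s * (A> h z + E z - E x)
      A>-run {x} x≤z = trans (A>-∷ h x) (*-congˡ (begin
        A> h x                      ≈⟨ solve 2 (λ a b → a := a :+ b :- b) refl _ _ ⟩
        A> h x + E x - E x          ≈⟨ +-congʳ (A>-total (All.map (ℕ.≤-trans x≤z) lower) (ℕ.≤-trans x≤z bound)) ⟩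
        sumUpTo N (λ y → u * (e y * s ^ countLt y h)) - E x ≈⟨ +-congʳ (A>-total lower bound) ⟨
        A> h z + E z - E x          ∎))
      continued : u * sumUpTo z (λ x → e x * Φ′ (x ∷ h) x) ≈ yₕ * sumUpTo z fY + Ψ * sumUpTo z fL
      continued = begin
        u * sumUpTo z (λ x → e x * Φ′ (x ∷ h) x) ≈⟨ sumUpTo-scale z u _ ⟨
        sumUpTo z (λ x → u * (e x * Φ′ (x ∷ h) x))
          ≈⟨ sumUpTo-cong z (λ x x≤z → trans
               (*-congˡ (*-congˡ (+-congˡ (*-congˡ (+-congʳ (*-congʳ (A>-run x≤z)))))))
               (solve 7 (λ u e Y y I ψ K → u :* (e :* ((Y :* y) :* I :+ ψ :* K)) :=
                                         y :* (u :* (e :* (Y :* I))) :+ ψ :* (u :* (e :* K))) refl _ _ _ _ _ _ _)) ⟩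
        sumUpTo z (λ x → yₕ * fY x + Ψ * fL x)        ≈⟨ sumUpTo-add z _ _ ⟩
        sumUpTo z (λ x → yₕ * fY x) + sumUpTo z (λ x → Ψ * fL x) ≈⟨ +-cong (sumUpTo-scale z yₕ fY) (sumUpTo-scale z Ψ fL) ⟩
        yₕ * sumUpTo z fY + Ψ * sumUpTo z fL ∎

    -- Both solve the same system with the same `Ψ`, and the factor u in front of the unknowns makes
    -- the solution unique. The induction on the degree runs over all states at once.
    Φ≈Φ′ : ∀ {h z} → Run h z → Φ h z ≈ Φ′ h z
    Φ≈Φ′ r = ≈[]⇒≈ (λ k → agree k r)
      where
      agree : ∀ k {h z} → Run h z → Φ h z ≈[ k ] Φ′ h z
      agree zero    r = ≈[]-zero
      agree (suc k) {h} {z} r = ≈[]-trans (≈⇒≈[] (Φ-unfold h z)) (≈[]-trans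
        (≈[]-+ ≈[]-refl (raise-u (sumUpTo-≈[] N (λ x _ → ≈[]-* ≈[]-refl (branch x)))))
        (≈⇒≈[] (sym (Φ′-unfold r))))
        where
        branch : ∀ x → (if z <ᵇ x then s ^ inv (x ∷ h) * Ψ else Φ (x ∷ h) x) ≈[ k ]
                       (if z <ᵇ x then s ^ inv (x ∷ h) * Ψ else Φ′ (x ∷ h) x)
        branch x with z ℕ.<? x
        ... | yes z<x rewrite <ᵇ-true z<x = ≈[]-refl
        ... | no z≮x rewrite <ᵇ-false (ℕ.≮⇒≥ z≮x) = agree k (run-∷ r (ℕ.≮⇒≥ z≮x))

    -- At the start the run is empty and its nominal first letter is `N`; no letter lies above it,
    -- so only `I Y N` and `Ψ * L N` survive in the closed form.
    Ψ-equation : Ψ * (1# - L N) ≈ I Y N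
    Ψ-equation = begin
      Ψ * (1# - L N)        ≈⟨ solve 2 (λ ψ l → ψ :* (con 1ℤ :- l) := ψ :- ψ :* l) refl _ _ ⟩
      Ψ - Ψ * L N           ≈⟨ +-congʳ (trans Ψ≈Φ (Φ≈Φ′ (record { lower = [] ; sorted = ≡.refl ; bound = ℕ.≤-refl }))) ⟩
      1# * I Y N + Ψ * (A> [] N * I s N + L N) - Ψ * L N
        ≈⟨ +-congʳ (+-congˡ (*-congˡ (+-congʳ (*-congʳ A>-empty)))) ⟩
      1# * I Y N + Ψ * (0# * I s N + L N) - Ψ * L N
        ≈⟨ solve 4 (λ I ψ i l → con 1ℤ :* I :+ ψ :* (con 0ℤ :* i :+ l) :- ψ :* l := I) refl _ _ _ _ ⟩
      I Y N                 ∎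
      where
      A>-empty : A> [] N ≈ 0#
      A>-empty = trans (sumUpTo-cong N (λ x x≤N → reflexive (if-≮ᵇ x≤N))) (sumUpTo-null N)

  private
    geo-cong : ∀ {x y} → x ≈ y → geo x ≈ geo y
    geo-cong x≈y = usum-cong (λ n → ^-cong x≈y (≡.refl {x = n}))

    suc-∸ : ∀ {m p} → m < p → p ∸ m ≡ suc (p ∸ suc m)
    suc-∸ {m} {suc p} (s≤s m≤p) = ℕ.+-∸-assoc 1 m≤p

    -- The exponents in `geoProd` decrease from p - 1, so each new factor cancels the last remaining
    -- factor of (b;q)_p.
    geoProd-poch : ∀ {a b} → b ≈ u * a → ∀ p m → m ≤ p → geoProd a p m * pochᵣ b p ≈ pochᵣ b (p ∸ m)
    geoProd-poch b≈ua p zero _ = *-identityˡ _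
    geoProd-poch {a} {b} b≈ua p (suc m) m<p = begin
      (geoProd a p m * g) * pochᵣ b p
        ≈⟨ solve 3 (λ G g P → (G :* g) :* P := g :* (G :* P)) refl _ _ _ ⟩
      g * (geoProd a p m * pochᵣ b p)
        ≈⟨ *-congˡ (trans (geoProd-poch b≈ua p m (ℕ.<⇒≤ m<p)) (reflexive (cong (pochᵣ b) (suc-∸ m<p)))) ⟩
      g * (P * (1# - b * c))                 ≈⟨ *-congˡ (*-congˡ (+-congˡ (-‿cong (*-congʳ b≈ua)))) ⟩
      g * (P * (1# - u * a * c))
        ≈⟨ solve 5 (λ g P u a c → g :* (P :* (con 1ℤ :- u :* a :* c)) := P :* (g :- u :* ((a :* c) :* g))) refl _ _ _ _ _ ⟩
      P * (g - u * ((a * c) * g))            ≈⟨ *-congˡ (+-congʳ (geo-unfold _)) ⟩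
      P * (1# + u * ((a * c) * g) - u * ((a * c) * g))
        ≈⟨ solve 2 (λ P x → P :* (con 1ℤ :+ x :- x) := P) refl _ _ ⟩
      P                                      ∎
      where
      c = q ^ (p ∸ suc m)
      g = geo (a * c)
      P = pochᵣ b (p ∸ suc m)

    geoProd-poch-inverse : ∀ {a b} → b ≈ u * a → ∀ p → geoProd a p p * pochᵣ b p ≈ 1#
    geoProd-poch-inverse {b = b} b≈ua p = trans (geoProd-poch b≈ua p p ℕ.≤-refl) (reflexive (cong (pochᵣ b) (ℕ.n∸n≡0 p)))

  module _ (r : ℕ) (N≡1+r : N ≡ suc r) where
    private
      e-suc : ∀ m → e (suc m) ≈ q ^ (r ∸ m)
      e-suc m = reflexive (cong (λ k → q ^ (k ∸ suc m)) N≡1+r)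

      e-step : ∀ {m} → m < r → e (suc m) ≈ q * e (suc (suc m))
      e-step {m} m<r = begin
        e (suc m)              ≈⟨ e-suc m ⟩
        q ^ (r ∸ m)            ≈⟨ reflexive (cong (q ^_) (suc-∸ m<r)) ⟩
        q * q ^ (r ∸ suc m)    ≈⟨ *-congˡ (e-suc (suc m)) ⟨
        q * e (suc (suc m))    ∎

      J : ℕ → Carrier
      J = geoProd 1# r

      -- The telescoping, as an induction on the largest letter. Neighbouring weights differ by a
      -- factor q, so the factor by which `I s m` differs from `I′` is 1 - u s q e′. Subtracting (1
      -- - sq) u e′ removes the terms with s and leaves 1 - u e′, which cancels g. For m = 0 there
      -- is a single letter and hence no hook.
      L-closed : ∀ m → m ≤ r → (1# - s * q) * (1# - L (suc m)) ≈ I s m - s * q * J m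
      L-closed zero _ = solve 5 (λ s q g u e →
        (con 1ℤ :- s :* q) :* (con 1ℤ :- g :* (u :* (e :* (con 1ℤ :- con 1ℤ)) :+ con 0ℤ)) := con 1ℤ :- s :* q :* con 1ℤ)
        refl _ _ _ _ _
      L-closed (suc m) m<r = begin
        (1# - s * q) * (1# - g * (u * (e′ * (I′ - 1#)) + L (suc m)))
          ≈⟨ *-congˡ (+-congʳ unit) ⟩
        (1# - s * q) * (g - u * (e′ * g) - g * (u * (e′ * (I′ - 1#)) + L (suc m)))
          ≈⟨ solve 7 (λ s q g u e I l →
               (con 1ℤ :- s :* q) :* (g :- u :* (e :* g) :- g :* (u :* (e :* (I :- con 1ℤ)) :+ l)) :=
               g :* ((con 1ℤ :- s :* q) :* (con 1ℤ :- l)) :- (con 1ℤ :- s :* q) :* (g :* (u :* (e :* I))))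
               refl _ _ _ _ _ _ _ ⟩
        g * ((1# - s * q) * (1# - L (suc m))) - rest
          ≈⟨ +-congʳ (*-congˡ (trans (L-closed m (ℕ.<⇒≤ m<r)) (+-congʳ I-step))) ⟩
        g * (I′ - u * (q * e′ * (s * I′)) - s * q * J m) - rest
          ≈⟨ solve 7 (λ s q g u e I J →
               g :* (I :- u :* (q :* e :* (s :* I)) :- s :* q :* J) :- (con 1ℤ :- s :* q) :* (g :* (u :* (e :* I))) :=
               I :* (g :- u :* (e :* g)) :- s :* q :* (J :* g)) refl _ _ _ _ _ _ _ ⟩
        I′ * (g - u * (e′ * g)) - s * q * (J m * g)
          ≈⟨ +-cong (trans (*-congˡ (sym unit)) (*-identityʳ _))
                    (-‿cong (*-congˡ (*-congˡ (geo-cong (trans (e-suc (suc m)) (sym (*-identityˡ _))))))) ⟩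
        I′ - s * q * J (suc m) ∎
        where
        e′ = e (suc (suc m))
        g = geo e′
        I′ = I s (suc m)
        rest = (1# - s * q) * (g * (u * (e′ * I′)))
        unit : 1# ≈ g - u * (e′ * g)
        unit = trans (solve 1 (λ x → con 1ℤ := con 1ℤ :+ x :- x) refl _) (+-congʳ (sym (geo-unfold e′)))
        I-step : I s m ≈ I′ - u * (q * e′ * (s * I′))
        I-step = begin
          I s m                                                          ≈⟨ solve 2 (λ a b → a := a :+ b :- b) refl _ _ ⟩
          I s m + u * (e (suc m) * (s * I′)) - u * (e (suc m) * (s * I′)) ≈⟨ +-cong (sym (I-unfold s m)) (-‿cong (*-congˡ (*-congʳ (e-step m<r)))) ⟩
          I′ - u * (q * e′ * (s * I′))                                   ∎

      -- The letters at most r lie below the largest letter r + 1, so each of their weights contains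
      -- a factor q, which is moved into the mark s.
      I-shift : ∀ m → m ≤ r → I s m ≈ geoProd (s * q) r m
      I-shift zero    _   = refl
      I-shift (suc m) m<r = *-cong (I-shift m (ℕ.<⇒≤ m<r)) (geo-cong (begin
        s * e (suc m)                ≈⟨ *-congˡ (trans (e-suc m) (reflexive (cong (q ^_) (suc-∸ m<r)))) ⟩
        s * (q * q ^ (r ∸ suc m))    ≈⟨ *-assoc _ _ _ ⟨
        s * q * q ^ (r ∸ suc m)      ∎))

    hook-identity : ((pochᵣ u r - s * q * pochᵣ (u * s * q) r) * pochᵣ (u * Y) (suc r)) * Ψ ≈
                    (1# - q * s) * pochᵣ u r * pochᵣ (u * s * q) r
    hook-identity = begin
      ((a - s * q * b) * c) * Ψ
        ≈⟨ solve 6 (λ a b c ψ s q → ((a :- s :* q :* b) :* c) :* ψ := (a :* con 1ℤ :- s :* q :* (b :* con 1ℤ)) :* c :* ψ) refl _ _ _ _ _ _ ⟩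
      (a * 1# - s * q * (b * 1#)) * c * Ψ
        -- Each unit becomes a symbol times its inverse, so that a b c factors out and the closed
        -- form of (1 - sq)(1 - L) remains.
        ≈⟨ *-congʳ (*-congʳ (+-cong (*-congˡ (sym b⁻¹)) (-‿cong (*-congˡ (*-congˡ (sym a⁻¹)))))) ⟩
      (a * (b′ * b) - s * q * (b * (a′ * a))) * c * Ψ
        ≈⟨ solve 8 (λ a b c ψ s q a′ b′ → (a :* (b′ :* b) :- s :* q :* (b :* (a′ :* a))) :* c :* ψ :=
                                       (a :* b :* c) :* (ψ :* (b′ :- s :* q :* a′))) refl _ _ _ _ _ _ _ _ ⟩
      (a * b * c) * (Ψ * (b′ - s * q * a′))
        ≈⟨ *-congˡ (*-congˡ (trans (+-congʳ (sym (I-shift r ℕ.≤-refl))) (sym (L-closed r ℕ.≤-refl)))) ⟩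
      (a * b * c) * (Ψ * ((1# - s * q) * (1# - L (suc r))))
        ≈⟨ solve 6 (λ a b c ψ w l → (a :* b :* c) :* (ψ :* (w :* l)) := (w :* a :* b) :* c :* (ψ :* l)) refl _ _ _ _ _ _ ⟩
      ((1# - s * q) * a * b) * c * (Ψ * (1# - L (suc r)))
        ≈⟨ *-congˡ (trans (reflexive (cong (λ k → Ψ * (1# - L k)) (≡.sym N≡1+r))) Ψ-equation) ⟩
      ((1# - s * q) * a * b) * c * I Y N
        ≈⟨ *-congˡ (reflexive (cong (λ k → geoProd Y k k) N≡1+r)) ⟩
      ((1# - s * q) * a * b) * c * geoProd Y (suc r) (suc r)
        ≈⟨ trans (*-assoc _ _ _) (*-congˡ (trans (*-comm _ _) (geoProd-poch-inverse refl (suc r)))) ⟩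
      ((1# - s * q) * a * b) * 1#
        ≈⟨ solve 4 (λ s q a b → ((con 1ℤ :- s :* q) :* a :* b) :* con 1ℤ := (con 1ℤ :- q :* s) :* a :* b) refl _ _ _ _ ⟩
      (1# - q * s) * a * b ∎
      where
      a = pochᵣ u r
      b = pochᵣ (u * s * q) r
      c = pochᵣ (u * Y) (suc r)
      a′ = geoProd 1# r r
      b′ = geoProd (s * q) r r
      a⁻¹ : a′ * a ≈ 1#
      a⁻¹ = geoProd-poch-inverse (sym (*-identityʳ u)) r
      b⁻¹ : b′ * b ≈ 1#
      b⁻¹ = geoProd-poch-inverse (*-assoc u s q) r

-- From words back to permutations

module HookDistribution (A : SeriesAlgebra) where
  open SeriesTheory A
  module Hooks (N : ℕ) = HookSeries A N
  open Hooks using (weight; Ψₙ; Ψ)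

  stat : ℕ × ℕ → Carrier
  stat = Hooks.stat 0

  private
    weight-↭ : ∀ N {v w} → v ↭ w → weight N v ≈ weight N w
    weight-↭ N Perm.refl         = refl
    weight-↭ N (Perm.prep x p)   = *-congˡ (weight-↭ N p)
    weight-↭ N (Perm.swap x y p) = trans (*-congˡ (*-congˡ (weight-↭ N p)))
      (solve 3 (λ a b c → a :* (b :* c) := b :* (a :* c)) refl _ _ _)
    weight-↭ N (Perm.trans p p′) = trans (weight-↭ N p) (weight-↭ N p′)

    -- `chains` climbs from `lo`, while `chainPoly` descends from b. Since lo + b = N + 1, the
    -- letter `lo` has weight q^(b-1), the largest power that `chainPoly b` admits.
    Σ-chains : ∀ N lo b τ → lo ℕ.+ b ≡ suc N → Σ (chains lo b τ) (weight N) ≈ chainPoly b τ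
    Σ-chains N lo b       []      eq = +-identityʳ 1#
    Σ-chains N lo zero    (x ∷ τ) eq = refl
    Σ-chains N lo (suc b) (x ∷ τ) eq = begin
      Σ (chains (suc lo) b (x ∷ τ) ++ map (lo ∷_) rest) (weight N)
        ≈⟨ Σ-++ (chains (suc lo) b (x ∷ τ)) ⟩
      Σ (chains (suc lo) b (x ∷ τ)) (weight N) + Σ (map (lo ∷_) rest) (weight N)
        ≈⟨ +-cong (Σ-chains N (suc lo) b (x ∷ τ) eq′) (trans (Σ-map (lo ∷_) rest) (Σ-scale (q ^ (N ∸ lo)) rest (weight N))) ⟩
      chainPoly b (x ∷ τ) + q ^ (N ∸ lo) * Σ rest (weight N)
        ≈⟨ +-congˡ (*-cong (reflexive (cong (q ^_) N∸lo)) (Σ-chains N _ _ τ (bound-∷ {lo} {b} (desAt≤1 x τ) eq))) ⟩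
      chainPoly (suc b) (x ∷ τ) ∎
      where
      rest = chains (lo ℕ.+ desAt x τ) (suc b ∸ desAt x τ) τ
      eq′ : suc lo ℕ.+ b ≡ suc N
      eq′ = ≡.trans (≡.sym (ℕ.+-suc lo b)) eq
      N∸lo : N ∸ lo ≡ b
      N∸lo = ≡.trans (cong (_∸ lo) (≡.sym (ℕ.suc-injective eq′))) (ℕ.m+n∸m≡n lo b)

    Ψₙ-perms : ∀ N n → Ψₙ N n ≈ Σ (perms n) (λ σ → stat (hookRev (revℕ σ)) * chainPoly N (inverse σ))
    Ψₙ-perms N n = begin
      Σ (words N n) (λ w → weight N w * stat (hookRev w))
        ≈⟨ Σ-↭ _ (words-reverse N n) ⟨
      Σ (map revℕ (words N n)) (λ w → weight N w * stat (hookRev w))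
        ≈⟨ Σ-map revℕ (words N n) ⟩
      Σ (words N n) (λ w → weight N (revℕ w) * stat (hookRev (revℕ w)))
        ≈⟨ Σ-cong (words N n) (λ {w} _ → *-congʳ (weight-↭ N (revℕ-↭ w))) ⟩
      Σ (words N n) (λ w → weight N w * stat (hookRev (revℕ w)))
        ≈⟨ Σ-↭ _ (permChains-↭ N n) ⟨
      Σ (map apply (permChains N n)) (λ w → weight N w * stat (hookRev (revℕ w)))
        ≈⟨ Σ-map apply (permChains N n) ⟩
      Σ (permChains N n) (λ p → weight N (apply p) * stat (hookRev (revℕ (apply p))))
        ≈⟨ Σ-cong (permChains N n) (λ {p} → termwise {p}) ⟩
      Σ (permChains N n) (λ (σ , c) → weight N c * stat (hookRev (revℕ σ)))
        ≈⟨ Σ-concatMap (λ σ → map (σ ,_) (chains 1 N (inverse σ))) (perms n) ⟩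
      Σ (perms n) (λ σ → Σ (map (σ ,_) (chains 1 N (inverse σ))) (λ (σ , c) → weight N c * stat (hookRev (revℕ σ))))
        ≈⟨ Σ-cong (perms n) (λ {σ} _ → trans (Σ-map (σ ,_) (chains 1 N (inverse σ)))
             (trans (Σ-cong (chains 1 N (inverse σ)) (λ _ → *-comm _ _))
             (trans (Σ-scale (stat (hookRev (revℕ σ))) (chains 1 N (inverse σ)) (weight N))
                    (*-congˡ (Σ-chains N 1 N (inverse σ) ≡.refl))))) ⟩
      Σ (perms n) (λ σ → stat (hookRev (revℕ σ)) * chainPoly N (inverse σ)) ∎
      where
      termwise : ∀ {p} → p ∈ permChains N n →
                 weight N (apply p) * stat (hookRev (revℕ (apply p))) ≈ weight N (proj₂ p) * stat (hookRev (revℕ (proj₁ p)))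
      termwise p∈ = let σ↭ , chain = ∈-permChains⁻ {N} {n} p∈ in
        *-cong (weight-↭ N (apply-↭ {N} {n} σ↭ chain)) (reflexive (cong stat (hookRev-apply {N} {n} σ↭ chain)))

  permSum : ℕ → Carrier
  permSum n = Σ (perms n) (λ σ → s ^ lec σ * (t ^ ides σ * (q ^ imaj σ * Y ^ pix σ)))

  private
    tsum-Ψₙ : ∀ n → pochᵣ t (suc n) * tsum* (λ r → Ψₙ (suc r) n) ≈ permSum n
    tsum-Ψₙ n = begin
      P * tsum* (λ r → Ψₙ (suc r) n)
        ≈⟨ *-congˡ (tsum-cong (λ r → Ψₙ-perms (suc r) n)) ⟩
      P * tsum* (λ r → Σ (perms n) (λ σ → stat (hookRev (revℕ σ)) * chainPoly (suc r) (inverse σ)))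
        ≈⟨ *-congˡ (tsum-Σ (perms n) (λ σ r → stat (hookRev (revℕ σ)) * chainPoly (suc r) (inverse σ))) ⟩
      P * Σ (perms n) (λ σ → tsum* (λ r → stat (hookRev (revℕ σ)) * chainPoly (suc r) (inverse σ)))
        ≈⟨ Σ-scale P (perms n) _ ⟨
      Σ (perms n) (λ σ → P * tsum* (λ r → stat (hookRev (revℕ σ)) * chainPoly (suc r) (inverse σ)))
        ≈⟨ Σ-cong (perms n) (λ {σ} → termwise {σ}) ⟩
      permSum n ∎
      where
      P = pochᵣ t (suc n)
      termwise : ∀ {σ} → σ ∈ perms n → P * tsum* (λ r → stat (hookRev (revℕ σ)) * chainPoly (suc r) (inverse σ)) ≈
                 s ^ lec σ * (t ^ ides σ * (q ^ imaj σ * Y ^ pix σ))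
      termwise {σ} σ∈ = begin
        P * tsum* (λ r → st * chainPoly (suc r) (inverse σ))
          ≈⟨ *-congˡ (TSum.scale st (λ r → chainPoly (suc r) (inverse σ))) ⟩
        P * (st * tsum* (λ r → chainPoly (suc r) (inverse σ)))
          ≈⟨ solve 3 (λ P s c → P :* (s :* c) := s :* (P :* c)) refl _ _ _ ⟩
        st * (P * tsum* (λ r → chainPoly (suc r) (inverse σ)))
          ≈⟨ *-congˡ (trans (*-congʳ (reflexive (cong (λ k → pochᵣ t (suc k)) (≡.sym (perm-length (inverse-↭ (∈-perms⁻ {n} σ∈)))))))
                            (macMahon (inverse σ))) ⟩
        (s ^ lec σ * Y ^ pix σ) * (t ^ ides σ * q ^ imaj σ)
          ≈⟨ solve 4 (λ s y t q → (s :* y) :* (t :* q) := s :* (t :* (q :* y))) refl _ _ _ _ ⟩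
        s ^ lec σ * (t ^ ides σ * (q ^ imaj σ * Y ^ pix σ)) ∎
        where st = stat (hookRev (revℕ σ))

    pochᵣ-regular : ∀ {a} → Raises a → ∀ n → Regular (pochᵣ a n)
    pochᵣ-regular raise zero    eq = trans (sym (*-identityˡ _)) (trans eq (*-identityˡ _))
    pochᵣ-regular raise (suc n) = regular-* (pochᵣ-regular raise n) (raises-regular (raises-*ˡ (q ^ n) raise))

  numerᵣ denomᵣ : ℕ → Carrier
  numerᵣ r = (1# - q * s) * pochᵣ u r * pochᵣ (u * s * q) r
  denomᵣ r = (pochᵣ u r - s * q * pochᵣ (u * s * q) r) * pochᵣ (u * Y) (suc r)

  numerᵣ-regular : ∀ r → Regular (numerᵣ r)
  numerᵣ-regular r = regular-*
    (regular-* (raises-regular (raises-*ˡ s raise-q)) (pochᵣ-regular raise-u r))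
    (pochᵣ-regular (raises-*ˡ q (raises-*ˡ s raise-u)) r)

  -- Cancelling n instead of d: the numerator is a product of factors 1 - v covered by
  -- `raises-regular`, whereas the denominator contains a difference of such products.
  quotient-unique : ∀ {n d x y} → Regular n → d * x ≈ n → d * y ≈ n → x ≈ y
  quotient-unique {n} {d} {x} {y} reg dx dy = reg (begin
    n * x       ≈⟨ *-congʳ dy ⟨
    (d * y) * x ≈⟨ solve 3 (λ d x y → (d :* y) :* x := (d :* x) :* y) refl _ _ _ ⟩
    (d * x) * y ≈⟨ *-congʳ dx ⟩
    n * y       ∎)

  hook-distribution : (G H : ℕ → Carrier) →
    (∀ r → denomᵣ r * G r ≈ numerᵣ r) → (∀ n → pochᵣ t (suc n) * H n ≈ 1#) →
    tsum* G ≈ usum* (λ n → permSum n * H n)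
  hook-distribution G H hG hH = begin
    tsum* G
      ≈⟨ tsum-cong (λ r → quotient-unique (numerᵣ-regular r) (hG r) (Hooks.hook-identity (suc r) r ≡.refl)) ⟩
    tsum* (λ r → usum* (Ψₙ (suc r)))                     ≈⟨ usum-tsum (λ n r → Ψₙ (suc r) n) ⟨
    usum* (λ n → tsum* (λ r → Ψₙ (suc r) n))             ≈⟨ usum-cong cleared ⟩
    usum* (λ n → permSum n * H n)                        ∎
    where
    cleared : ∀ n → tsum* (λ r → Ψₙ (suc r) n) ≈ permSum n * H n
    cleared n = begin
      E             ≈⟨ *-identityˡ E ⟨
      1# * E        ≈⟨ *-congʳ (hH n) ⟨
      (P * H n) * E ≈⟨ solve 3 (λ P h E → (P :* h) :* E := (P :* E) :* h) refl _ _ _ ⟩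
      (P * E) * H n ≈⟨ *-congʳ (tsum-Ψₙ n) ⟩
      permSum n * H n ∎
      where
      P = pochᵣ t (suc n)
      E = tsum* (λ r → Ψₙ (suc r) n)

open import Defs using (_≈_)

-- The ring of power series in one variable

module PowerSeries (R : CommutativeRing 0ℓ 0ℓ) where
  open CommutativeRing R hiding (zero) renaming (_≈_ to _≈R_)
  open SetoidReasoning setoid

  -- The Cauchy product, by recursion along the shifts of the left factor. It avoids differences of
  -- indices, and the ring laws follow by induction on the index.
  conv : (ℕ → Carrier) → (ℕ → Carrier) → ℕ → Carrier
  conv f g zero    = f 0 * g 0
  conv f g (suc n) = f 0 * g (suc n) + conv (f ∘ suc) g n

  const : Carrier → ℕ → Carrier
  const x zero    = x
  const x (suc n) = 0#

  private
    _≋_ : (f g : ℕ → Carrier) → Set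
    f ≋ g = ∀ n → f n ≈R g n

    conv-cong : ∀ {f f′ g g′} → f ≋ f′ → g ≋ g′ → conv f g ≋ conv f′ g′
    conv-cong p q zero    = *-cong (p 0) (q 0)
    conv-cong p q (suc n) = +-cong (*-cong (p 0) (q (suc n))) (conv-cong (p ∘ suc) q n)

    interchange : ∀ a b c d → (a + b) + (c + d) ≈R (a + c) + (b + d)
    interchange a b c d = begin
      (a + b) + (c + d) ≈⟨ +-assoc _ _ _ ⟩
      a + (b + (c + d)) ≈⟨ +-congˡ (+-assoc _ _ _) ⟨
      a + ((b + c) + d) ≈⟨ +-congˡ (+-congʳ (+-comm _ _)) ⟩
      a + ((c + b) + d) ≈⟨ +-congˡ (+-assoc _ _ _) ⟩
      a + (c + (b + d)) ≈⟨ +-assoc _ _ _ ⟨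
      (a + c) + (b + d) ∎

    conv-distribʳ : ∀ f g h → conv (λ n → f n + g n) h ≋ (λ n → conv f h n + conv g h n)
    conv-distribʳ f g h zero    = distribʳ _ _ _
    conv-distribʳ f g h (suc n) = begin
      (f 0 + g 0) * h (suc n) + conv (λ n → f (suc n) + g (suc n)) h n
        ≈⟨ +-cong (distribʳ _ _ _) (conv-distribʳ (f ∘ suc) (g ∘ suc) h n) ⟩
      (f 0 * h (suc n) + g 0 * h (suc n)) + (conv (f ∘ suc) h n + conv (g ∘ suc) h n)
        ≈⟨ interchange _ _ _ _ ⟩
      (f 0 * h (suc n) + conv (f ∘ suc) h n) + (g 0 * h (suc n) + conv (g ∘ suc) h n) ∎

    conv-scale : ∀ x f g → conv (λ n → x * f n) g ≋ (λ n → x * conv f g n)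
    conv-scale x f g zero    = *-assoc _ _ _
    conv-scale x f g (suc n) = begin
      (x * f 0) * g (suc n) + conv (λ n → x * f (suc n)) g n
        ≈⟨ +-cong (*-assoc _ _ _) (conv-scale x (f ∘ suc) g n) ⟩
      x * (f 0 * g (suc n)) + x * conv (f ∘ suc) g n
        ≈⟨ distribˡ _ _ _ ⟨
      x * (f 0 * g (suc n) + conv (f ∘ suc) g n) ∎

    conv-assoc : ∀ f g h → conv (conv f g) h ≋ conv f (conv g h)
    conv-assoc f g h zero    = *-assoc _ _ _
    conv-assoc f g h (suc n) = begin
      (f 0 * g 0) * h (suc n) + conv (λ n → f 0 * g (suc n) + conv (f ∘ suc) g n) h n
        ≈⟨ +-congˡ (conv-distribʳ (λ n → f 0 * g (suc n)) (conv (f ∘ suc) g) h n) ⟩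
      (f 0 * g 0) * h (suc n) + (conv (λ n → f 0 * g (suc n)) h n + conv (conv (f ∘ suc) g) h n)
        ≈⟨ +-cong (*-assoc _ _ _) (+-cong (conv-scale (f 0) (g ∘ suc) h n) (conv-assoc (f ∘ suc) g h n)) ⟩
      f 0 * (g 0 * h (suc n)) + (f 0 * conv (g ∘ suc) h n + conv (f ∘ suc) (conv g h) n)
        ≈⟨ +-assoc _ _ _ ⟨
      (f 0 * (g 0 * h (suc n)) + f 0 * conv (g ∘ suc) h n) + conv (f ∘ suc) (conv g h) n
        ≈⟨ +-congʳ (distribˡ _ _ _) ⟨
      f 0 * (g 0 * h (suc n) + conv (g ∘ suc) h n) + conv (f ∘ suc) (conv g h) n ∎

    conv-unfoldʳ : ∀ f g n → conv f g (suc n) ≈R conv f (g ∘ suc) n + f (suc n) * g 0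
    conv-unfoldʳ f g zero    = refl
    conv-unfoldʳ f g (suc n) = begin
      f 0 * g (suc (suc n)) + conv (f ∘ suc) g (suc n)
        ≈⟨ +-congˡ (conv-unfoldʳ (f ∘ suc) g n) ⟩
      f 0 * g (suc (suc n)) + (conv (f ∘ suc) (g ∘ suc) n + f (suc (suc n)) * g 0)
        ≈⟨ +-assoc _ _ _ ⟨
      (f 0 * g (suc (suc n)) + conv (f ∘ suc) (g ∘ suc) n) + f (suc (suc n)) * g 0 ∎

    conv-comm : ∀ f g → conv f g ≋ conv g f
    conv-comm f g zero    = *-comm _ _
    conv-comm f g (suc n) = begin
      f 0 * g (suc n) + conv (f ∘ suc) g n ≈⟨ +-cong (*-comm _ _) (conv-comm (f ∘ suc) g n) ⟩
      g (suc n) * f 0 + conv g (f ∘ suc) n ≈⟨ +-comm _ _ ⟩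
      conv g (f ∘ suc) n + g (suc n) * f 0 ≈⟨ conv-unfoldʳ g f n ⟨
      conv g f (suc n) ∎

    conv-zeroˡ : ∀ g → conv (λ _ → 0#) g ≋ (λ _ → 0#)
    conv-zeroˡ g zero    = zeroˡ _
    conv-zeroˡ g (suc n) = trans (+-cong (zeroˡ _) (conv-zeroˡ g n)) (+-identityˡ _)

    conv-identityˡ : ∀ f → conv (const 1#) f ≋ f
    conv-identityˡ f zero    = *-identityˡ _
    conv-identityˡ f (suc n) = trans (+-cong (*-identityˡ _) (conv-zeroˡ f n)) (+-identityʳ _)

  seriesRing : CommutativeRing 0ℓ 0ℓ
  seriesRing = record
    { Carrier = ℕ → Carrier
    ; _≈_     = _≋_
    ; _+_     = λ f g n → f n + g n
    ; _*_     = conv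
    ; -_      = λ f n → - f n
    ; 0#      = λ _ → 0#
    ; 1#      = const 1#
    ; isCommutativeRing = record
      { isRing = record
        { +-isAbelianGroup = Pointwise.isAbelianGroup ℕ +-isAbelianGroup
        ; *-cong     = conv-cong
        ; *-assoc    = conv-assoc
        ; *-identity = conv-identityˡ , λ f n → trans (conv-comm f (const 1#) n) (conv-identityˡ f n)
        ; distrib    = (λ h f g n → begin
            conv h (λ n → f n + g n) n ≈⟨ conv-comm h (λ n → f n + g n) n ⟩
            conv (λ n → f n + g n) h n ≈⟨ conv-distribʳ f g h n ⟩
            conv f h n + conv g h n    ≈⟨ +-cong (conv-comm f h n) (conv-comm g h n) ⟩
            conv h f n + conv h g n    ∎)
          , (λ h f g → conv-distribʳ f g h)
        }
      ; *-comm = conv-comm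
      }
    }

-- Five variables by iteration

sumTo-cong : ∀ n {h k : ℕ → ℤ} → (∀ i → i ≤ n → h i ≡ k i) → sumTo n h ≡ sumTo n k
sumTo-cong zero    p = p 0 z≤n
sumTo-cong (suc n) p = cong₂ ℤ._+_ (sumTo-cong n (λ i i≤n → p i (ℕ.m≤n⇒m≤1+n i≤n))) (p (suc n) ℕ.≤-refl)

sumTo-suc : ∀ n (h : ℕ → ℤ) → sumTo (suc n) h ≡ h 0 ℤ.+ sumTo n (h ∘ suc)
sumTo-suc zero    h = ≡.refl
sumTo-suc (suc n) h = ≡.trans (cong (ℤ._+ h (suc (suc n))) (sumTo-suc n h)) (ℤ.+-assoc (h 0) _ _)

module _ (R : CommutativeRing 0ℓ 0ℓ) where
  open CommutativeRing R hiding (zero) renaming (_≈_ to _≈R_)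
  open PowerSeries R using (conv)

  -- Coefficients of an iterated series are again series. `ev` reads off one integer coefficient of
  -- them, and additivity is enough to carry it through the sum; one use for each variable gives the
  -- five-fold sum.
  conv-sumTo : (ev : Carrier → ℤ) → (∀ x y → ev (x + y) ≡ ev x ℤ.+ ev y) →
               ∀ f g n → ev (conv f g n) ≡ sumTo n (λ i → ev (f i * g (n ∸ i)))
  conv-sumTo ev ev-+ f g zero    = ≡.refl
  conv-sumTo ev ev-+ f g (suc n) = ≡.trans (ev-+ _ _)
    (≡.trans (cong (λ w → ev (f 0 * g (suc n)) ℤ.+ w) (conv-sumTo ev ev-+ (f ∘ suc) g n))
             (≡.sym (sumTo-suc n _)))

  module _ (_⊙_ : Carrier → Carrier → Carrier) (ε : Carrier)
           (⊙≈* : ∀ x y → x ⊙ y ≈R x * y) (ε≈1 : ε ≈R 1#) where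
    open SetoidReasoning setoid

    -- The ring laws are proved for the iterated Cauchy product; this carries them over to a ring
    -- whose product and unit are literally those of the statement.
    replaceMultiplication : CommutativeRing 0ℓ 0ℓ
    replaceMultiplication = record
      { Carrier = Carrier
      ; _≈_ = _≈R_ ; _+_ = _+_ ; _*_ = _⊙_ ; -_ = -_ ; 0# = 0# ; 1# = ε
      ; isCommutativeRing = record
        { isRing = record
          { +-isAbelianGroup = +-isAbelianGroup
          ; *-cong     = λ {x} {x′} {y} {y′} p q → begin
              x ⊙ y   ≈⟨ ⊙≈* x y ⟩
              x * y   ≈⟨ *-cong p q ⟩
              x′ * y′ ≈⟨ ⊙≈* x′ y′ ⟨
              x′ ⊙ y′ ∎
          ; *-assoc    = λ x y z → begin
              (x ⊙ y) ⊙ z ≈⟨ ⊙≈* (x ⊙ y) z ⟩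
              (x ⊙ y) * z ≈⟨ *-congʳ (⊙≈* x y) ⟩
              (x * y) * z ≈⟨ *-assoc x y z ⟩
              x * (y * z) ≈⟨ *-congˡ (⊙≈* y z) ⟨
              x * (y ⊙ z) ≈⟨ ⊙≈* x (y ⊙ z) ⟨
              x ⊙ (y ⊙ z) ∎
          ; *-identity = identityˡ , λ x → trans (⊙-comm x ε) (identityˡ x)
          ; distrib    = (λ x y z → begin
              x ⊙ (y + z)       ≈⟨ ⊙≈* x (y + z) ⟩
              x * (y + z)       ≈⟨ distribˡ x y z ⟩
              x * y + x * z     ≈⟨ +-cong (⊙≈* x y) (⊙≈* x z) ⟨
              (x ⊙ y) + (x ⊙ z) ∎)
            , (λ x y z → begin
              (y + z) ⊙ x       ≈⟨ ⊙≈* (y + z) x ⟩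
              (y + z) * x       ≈⟨ distribʳ x y z ⟩
              y * x + z * x     ≈⟨ +-cong (⊙≈* y x) (⊙≈* z x) ⟨
              (y ⊙ x) + (z ⊙ x) ∎)
          }
        ; *-comm = ⊙-comm
        }
      }
      where
      ⊙-comm : ∀ x y → x ⊙ y ≈R y ⊙ x
      ⊙-comm x y = begin
        x ⊙ y ≈⟨ ⊙≈* x y ⟩
        x * y ≈⟨ *-comm x y ⟩
        y * x ≈⟨ ⊙≈* y x ⟨
        y ⊙ x ∎
      identityˡ : ∀ x → ε ⊙ x ≈R x
      identityˡ x = begin
        ε ⊙ x  ≈⟨ ⊙≈* ε x ⟩
        ε * x  ≈⟨ *-congʳ ε≈1 ⟩
        1# * x ≈⟨ *-identityˡ x ⟩
        x      ∎

private
  R₁ R₂ R₃ R₄ R₅ : CommutativeRing 0ℓ 0ℓ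
  R₁ = PowerSeries.seriesRing ℤ.+-*-commutativeRing
  R₂ = PowerSeries.seriesRing R₁
  R₃ = PowerSeries.seriesRing R₂
  R₄ = PowerSeries.seriesRing R₃
  R₅ = PowerSeries.seriesRing R₄

  ⊛≈conv : ∀ f g → f ⊛ g ≈ CommutativeRing._*_ R₅ f g
  ⊛≈conv f g a b c d e = ≡.sym (
    ≡.trans (conv-sumTo R₄ (λ x → x b c d e) (λ _ _ → ≡.refl) f g a) (sumTo-cong a λ a₁ _ →
    ≡.trans (conv-sumTo R₃ (λ x → x c d e) (λ _ _ → ≡.refl) (f a₁) (g (a ∸ a₁)) b) (sumTo-cong b λ b₁ _ →
    ≡.trans (conv-sumTo R₂ (λ x → x d e) (λ _ _ → ≡.refl) (f a₁ b₁) (g (a ∸ a₁) (b ∸ b₁)) c) (sumTo-cong c λ c₁ _ →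
    ≡.trans (conv-sumTo R₁ (λ x → x e) (λ _ _ → ≡.refl) (f a₁ b₁ c₁) (g (a ∸ a₁) (b ∸ b₁) (c ∸ c₁)) d) (sumTo-cong d λ d₁ _ →
    conv-sumTo ℤ.+-*-commutativeRing (λ x → x) (λ _ _ → ≡.refl) (f a₁ b₁ c₁ d₁) (g (a ∸ a₁) (b ∸ b₁) (c ∸ c₁) (d ∸ d₁)) e)))))

  𝟙≈one : 𝟙 ≈ CommutativeRing.1# R₅
  𝟙≈one zero zero zero zero zero = ≡.refl
  𝟙≈one zero zero zero zero (suc e) = ≡.refl
  𝟙≈one zero zero zero (suc d) zero = ≡.refl
  𝟙≈one zero zero zero (suc d) (suc e) = ≡.refl
  𝟙≈one zero zero (suc c) d e = cong (λ x → x ℤ.* δ 0 e) (ℤ.*-zeroˡ (δ 0 d))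
  𝟙≈one zero (suc b) c d e = cong (λ x → x ℤ.* δ 0 d ℤ.* δ 0 e) (ℤ.*-zeroˡ (δ 0 c))
  𝟙≈one (suc a) b c d e = cong (λ x → x ℤ.* δ 0 c ℤ.* δ 0 d ℤ.* δ 0 e) (ℤ.*-zeroˡ (δ 0 b))

psRing : CommutativeRing 0ℓ 0ℓ
psRing = replaceMultiplication R₅ _⊛_ 𝟙 ⊛≈conv 𝟙≈one

-- Multiplication by monomials and the filtration by total degree

private
  -- Equals h m if m is at most n, and 0 otherwise. The recursion computes for the exponents 0 and
  -- 1, so that multiplication by a variable reduces to a shift of coefficients.
  pick : ℕ → ℕ → (ℕ → ℤ) → ℤ
  pick zero    n       h = h 0
  pick (suc m) zero    h = 0ℤ
  pick (suc m) (suc n) h = pick m n (h ∘ suc)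

  sumTo-zero : ∀ n (h : ℕ → ℤ) → (∀ i → h i ≡ 0ℤ) → sumTo n h ≡ 0ℤ
  sumTo-zero zero    h p = p 0
  sumTo-zero (suc n) h p = cong₂ ℤ._+_ (sumTo-zero n h p) (p (suc n))

  zero-term : ∀ p x → (p ℤ.* 0ℤ) ℤ.* x ≡ 0ℤ
  zero-term p x = ≡.trans (cong (ℤ._* x) (ℤ.*-zeroʳ p)) (ℤ.*-zeroˡ x)

  -- The factor p carries the remaining deltas of a monomial, so the five sums collapse one after
  -- another from the inside.
  sumTo-δ : ∀ m n p (h : ℕ → ℤ) → sumTo n (λ i → (p ℤ.* δ m i) ℤ.* h i) ≡ p ℤ.* pick m n h
  sumTo-δ zero zero p h = cong (ℤ._* h 0) (ℤ.*-identityʳ p)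
  sumTo-δ zero (suc n) p h = ≡.trans (sumTo-suc n _) (≡.trans
    (cong₂ ℤ._+_ (cong (ℤ._* h 0) (ℤ.*-identityʳ p)) (sumTo-zero n _ (λ i → zero-term p (h (suc i)))))
    (ℤ.+-identityʳ _))
  sumTo-δ (suc m) zero p h = ≡.trans (zero-term p (h 0)) (≡.sym (ℤ.*-zeroʳ p))
  sumTo-δ (suc m) (suc n) p h = ≡.trans (sumTo-suc n _) (≡.trans
    (cong₂ ℤ._+_ (zero-term p (h 0)) (sumTo-δ m n p (h ∘ suc)))
    (ℤ.+-identityˡ _))

  mono-⊛ : ∀ i j k l m f a b c d e → (mono i j k l m ⊛ f) a b c d e ≡
    pick i a λ a₁ → pick j b λ b₁ → pick k c λ c₁ → pick l d λ d₁ → pick m e λ e₁ →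
    f (a ∸ a₁) (b ∸ b₁) (c ∸ c₁) (d ∸ d₁) (e ∸ e₁)
  mono-⊛ i j k l m f a b c d e =
    ≡.trans (sumTo-cong a λ a₁ _ →
      ≡.trans (sumTo-cong b λ b₁ _ →
        ≡.trans (sumTo-cong c λ c₁ _ →
          ≡.trans (sumTo-cong d λ d₁ _ →
            sumTo-δ m e (δ i a₁ ℤ.* δ j b₁ ℤ.* δ k c₁ ℤ.* δ l d₁) (λ e₁ → f (a ∸ a₁) (b ∸ b₁) (c ∸ c₁) (d ∸ d₁) (e ∸ e₁)))
          (sumTo-δ l d (δ i a₁ ℤ.* δ j b₁ ℤ.* δ k c₁) (hₗ a₁ b₁ c₁)))
        (sumTo-δ k c (δ i a₁ ℤ.* δ j b₁) (hₖ a₁ b₁)))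
      (≡.trans (sumTo-δ j b (δ i a₁) (hⱼ a₁))
               (cong (λ w → w ℤ.* pick j b (hⱼ a₁)) (≡.sym (ℤ.*-identityˡ (δ i a₁))))))
    (≡.trans (sumTo-δ i a 1ℤ (λ a₁ → pick j b (hⱼ a₁))) (ℤ.*-identityˡ (pick i a (λ a₁ → pick j b (hⱼ a₁)))))
    where
    hₗ : ℕ → ℕ → ℕ → ℕ → ℤ
    hₗ a₁ b₁ c₁ d₁ = pick m e λ e₁ → f (a ∸ a₁) (b ∸ b₁) (c ∸ c₁) (d ∸ d₁) (e ∸ e₁)
    hₖ : ℕ → ℕ → ℕ → ℤ
    hₖ a₁ b₁ c₁ = pick l d (hₗ a₁ b₁ c₁)
    hⱼ : ℕ → ℕ → ℤ
    hⱼ a₁ b₁ = pick k c (hₖ a₁ b₁)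

  sumTo-+ : ∀ n (h k : ℕ → ℤ) → sumTo n (λ i → h i ℤ.+ k i) ≡ sumTo n h ℤ.+ sumTo n k
  sumTo-+ zero h k = ≡.refl
  sumTo-+ (suc n) h k = ≡.trans (cong (λ w → w ℤ.+ (h (suc n) ℤ.+ k (suc n))) (sumTo-+ n h k))
    (interchange (sumTo n h) _ _ _)
    where open CommutativeSemigroupProperties ℤ.+-commutativeSemigroup using (interchange)

  sumTo-swap : ∀ m n (h : ℕ → ℕ → ℤ) → sumTo m (λ i → sumTo n (h i)) ≡ sumTo n (λ j → sumTo m (λ i → h i j))
  sumTo-swap zero n h = ≡.refl
  sumTo-swap (suc m) n h = ≡.trans (cong (λ w → w ℤ.+ sumTo n (h (suc m))) (sumTo-swap m n h))
    (≡.sym (sumTo-+ n _ _))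

  usum-unfold′ : ∀ F → usum F ≈ F 0 ⊕ U ⊛ usum (F ∘ suc)
  usum-unfold′ F a b c d zero    = ≡.sym (≡.trans (cong (λ w → F 0 a b c d 0 ℤ.+ w) (mono-⊛ 0 0 0 0 1 (usum (F ∘ suc)) a b c d 0))
     (ℤ.+-identityʳ _))
  usum-unfold′ F a b c d (suc e) = ≡.trans (sumTo-suc e _)
    (cong (λ w → F 0 a b c d (suc e) ℤ.+ w) (≡.sym (mono-⊛ 0 0 0 0 1 (usum (F ∘ suc)) a b c d (suc e))))

  tsum-unfold′ : ∀ F → tsum F ≈ F 0 ⊕ T ⊛ tsum (F ∘ suc)
  tsum-unfold′ F a zero c d e    = ≡.sym (≡.trans (cong (λ w → F 0 a 0 c d e ℤ.+ w) (mono-⊛ 0 1 0 0 0 (tsum (F ∘ suc)) a 0 c d e))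
     (ℤ.+-identityʳ _))
  tsum-unfold′ F a (suc b) c d e = ≡.trans (sumTo-suc b _)
    (cong (λ w → F 0 a (suc b) c d e ℤ.+ w) (≡.sym (mono-⊛ 0 1 0 0 0 (tsum (F ∘ suc)) a (suc b) c d e)))

  -- Total degree, because contraction is needed in u, t and q; one filtration serves all three.
  AgreeBelow : PS → ℕ → PS → Set
  AgreeBelow f k g = ∀ a b c d e → a ℕ.+ b ℕ.+ c ℕ.+ d ℕ.+ e < k → f a b c d e ≡ g a b c d e

  ⊛-agree : ∀ {k f f′ g g′} → AgreeBelow f k f′ → AgreeBelow g k g′ → AgreeBelow (f ⊛ g) k (f′ ⊛ g′)
  ⊛-agree {k} p r a b c d e lt =
    sumTo-cong a λ a₁ a₁≤ → sumTo-cong b λ b₁ b₁≤ → sumTo-cong c λ c₁ c₁≤ →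
    sumTo-cong d λ d₁ d₁≤ → sumTo-cong e λ e₁ e₁≤ →
    cong₂ ℤ._*_
      (p _ _ _ _ _ (ℕ.≤-<-trans (ℕ.+-mono-≤ (ℕ.+-mono-≤ (ℕ.+-mono-≤ (ℕ.+-mono-≤ a₁≤ b₁≤) c₁≤) d₁≤) e₁≤) lt))
      (r _ _ _ _ _ (ℕ.≤-<-trans
        (ℕ.+-mono-≤ (ℕ.+-mono-≤ (ℕ.+-mono-≤ (ℕ.+-mono-≤ (ℕ.m∸n≤m a a₁) (ℕ.m∸n≤m b b₁)) (ℕ.m∸n≤m c c₁)) (ℕ.m∸n≤m d d₁)) (ℕ.m∸n≤m e e₁)) lt))

  raise-U : ∀ {k f g} → AgreeBelow f k g → AgreeBelow (U ⊛ f) (suc k) (U ⊛ g)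
  raise-U {f = f} {g} p a b c d zero lt = ≡.trans (mono-⊛ 0 0 0 0 1 f a b c d 0) (≡.sym (mono-⊛ 0 0 0 0 1 g a b c d 0))
  raise-U {k} {f} {g} p a b c d (suc e) lt = ≡.trans (mono-⊛ 0 0 0 0 1 f a b c d (suc e)) (≡.trans
    (p a b c d e (ℕ.≤-pred (≡.subst (_< suc k) (ℕ.+-suc _ e) lt)))
    (≡.sym (mono-⊛ 0 0 0 0 1 g a b c d (suc e))))

  raise-T : ∀ {k f g} → AgreeBelow f k g → AgreeBelow (T ⊛ f) (suc k) (T ⊛ g)
  raise-T {f = f} {g} p a zero c d e lt = ≡.trans (mono-⊛ 0 1 0 0 0 f a 0 c d e) (≡.sym (mono-⊛ 0 1 0 0 0 g a 0 c d e))
  raise-T {k} {f} {g} p a (suc b) c d e lt = ≡.trans (mono-⊛ 0 1 0 0 0 f a (suc b) c d e) (≡.trans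
    (p a b c d e (ℕ.≤-pred (≡.subst (λ w → w ℕ.+ c ℕ.+ d ℕ.+ e < suc k) (ℕ.+-suc a b) lt)))
    (≡.sym (mono-⊛ 0 1 0 0 0 g a (suc b) c d e)))

  raise-Q : ∀ {k f g} → AgreeBelow f k g → AgreeBelow (Q ⊛ f) (suc k) (Q ⊛ g)
  raise-Q {f = f} {g} p a b zero d e lt = ≡.trans (mono-⊛ 0 0 1 0 0 f a b 0 d e) (≡.sym (mono-⊛ 0 0 1 0 0 g a b 0 d e))
  raise-Q {k} {f} {g} p a b (suc c) d e lt = ≡.trans (mono-⊛ 0 0 1 0 0 f a b (suc c) d e) (≡.trans
    (p a b c d e (ℕ.≤-pred (≡.subst (λ w → w ℕ.+ d ℕ.+ e < suc k) (ℕ.+-suc (a ℕ.+ b) c) lt)))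
    (≡.sym (mono-⊛ 0 0 1 0 0 g a b (suc c) d e)))

psAlgebra : SeriesAlgebra
psAlgebra = record
  { commutativeRing = psRing
  ; s = S ; t = T ; q = Q ; Y = Yv ; u = U
  ; usum* = usum
  ; tsum* = tsum
  ; usum-cong = λ p a b c d e → sumTo-cong e λ n _ → p n a b c d (e ∸ n)
  ; tsum-cong = λ p a b c d e → sumTo-cong b λ r _ → p r a (b ∸ r) c d e
  ; usum-unfold = usum-unfold′
  ; tsum-unfold = tsum-unfold′
  ; usum-tsum = λ F a b c d e → sumTo-swap e b λ n r → F n r a (b ∸ r) c d (e ∸ n)
  ; _≈[_]_ = AgreeBelow
  ; ≈[]-zero = λ _ _ _ _ _ ()
  ; ≈[]-trans = λ p r a b c d e lt → ≡.trans (p a b c d e lt) (r a b c d e lt)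
  ; ≈⇒≈[] = λ p a b c d e _ → p a b c d e
  -- A coefficient of total degree d is reached with k = d + 1.
  ; ≈[]⇒≈ = λ p a b c d e → p _ a b c d e ℕ.≤-refl
  ; ≈[]-+ = λ p r a b c d e lt → cong₂ ℤ._+_ (p a b c d e lt) (r a b c d e lt)
  ; ≈[]-* = ⊛-agree
  ; raise-u = raise-U
  ; raise-t = raise-T
  ; raise-q = raise-Q
  }

module PS where
  open CommutativeRing psRing public
  open Exp (CommutativeRing.commutativeSemiring psRing) public using (_^_)

-- Translation of the series in the statement

private
  S-mono : ∀ i j k l → mono (suc i) j k l 0 ≈ S ⊛ mono i j k l 0
  S-mono i j k l zero    b c d e = ≡.trans (cong (λ w → w ℤ.* δ k c ℤ.* δ l d ℤ.* δ 0 e) (ℤ.*-zeroˡ (δ j b)))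
     (≡.sym (mono-⊛ 1 0 0 0 0 (mono i j k l 0) 0 b c d e))
  S-mono i j k l (suc a) b c d e = ≡.sym (mono-⊛ 1 0 0 0 0 (mono i j k l 0) (suc a) b c d e)

  T-mono : ∀ j k l → mono 0 (suc j) k l 0 ≈ T ⊛ mono 0 j k l 0
  T-mono j k l a zero    c d e = ≡.trans (cong (λ w → w ℤ.* δ k c ℤ.* δ l d ℤ.* δ 0 e) (ℤ.*-zeroʳ (δ 0 a)))
     (≡.sym (mono-⊛ 0 1 0 0 0 (mono 0 j k l 0) a 0 c d e))
  T-mono j k l a (suc b) c d e = ≡.sym (mono-⊛ 0 1 0 0 0 (mono 0 j k l 0) a (suc b) c d e)

  Q-mono : ∀ k l → mono 0 0 (suc k) l 0 ≈ Q ⊛ mono 0 0 k l 0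
  Q-mono k l a b zero    d e = ≡.trans (cong (λ w → w ℤ.* δ l d ℤ.* δ 0 e) (ℤ.*-zeroʳ (δ 0 a ℤ.* δ 0 b)))
     (≡.sym (mono-⊛ 0 0 1 0 0 (mono 0 0 k l 0) a b 0 d e))
  Q-mono k l a b (suc c) d e = ≡.sym (mono-⊛ 0 0 1 0 0 (mono 0 0 k l 0) a b (suc c) d e)

  Y-mono : ∀ l → mono 0 0 0 (suc l) 0 ≈ Yv ⊛ mono 0 0 0 l 0
  Y-mono l a b c zero    e = ≡.trans (cong (λ w → w ℤ.* δ 0 e) (ℤ.*-zeroʳ (δ 0 a ℤ.* δ 0 b ℤ.* δ 0 c)))
     (≡.sym (mono-⊛ 0 0 0 1 0 (mono 0 0 0 l 0) a b c 0 e))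
  Y-mono l a b c (suc d) e = ≡.sym (mono-⊛ 0 0 0 1 0 (mono 0 0 0 l 0) a b c (suc d) e)

private
  *-power : ∀ x y m n r → y ≈ x ⊛ m → m ≈ (x PS.^ n) ⊛ r → y ≈ (x PS.^ suc n) ⊛ r
  *-power x y m n r y≈xm m≈p =
    PS.trans {y} {x ⊛ m} {(x PS.^ suc n) ⊛ r} y≈xm
    (PS.trans {x ⊛ m} {x ⊛ ((x PS.^ n) ⊛ r)} {(x PS.^ suc n) ⊛ r} (PS.*-congˡ {x} {m} {(x PS.^ n) ⊛ r} m≈p)
    (PS.sym {(x PS.^ suc n) ⊛ r} {x ⊛ ((x PS.^ n) ⊛ r)} (PS.*-assoc x (x PS.^ n) r)))

  1*-power : ∀ y r → y ≈ r → y ≈ 𝟙 ⊛ r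
  1*-power y r p = PS.trans {y} {r} {𝟙 ⊛ r} p (PS.sym {𝟙 ⊛ r} {r} (PS.*-identityˡ r))

  Y-power : ∀ l → mono 0 0 0 l 0 ≈ Yv PS.^ l
  Y-power zero    = PS.refl {𝟙}
  Y-power (suc l) = PS.trans {mono 0 0 0 (suc l) 0} {Yv ⊛ mono 0 0 0 l 0} {Yv PS.^ suc l}
    (Y-mono l) (PS.*-congˡ {Yv} {mono 0 0 0 l 0} {Yv PS.^ l} (Y-power l))

  Q-power : ∀ k l → mono 0 0 k l 0 ≈ (Q PS.^ k) ⊛ (Yv PS.^ l)
  Q-power zero    l = 1*-power (mono 0 0 0 l 0) (Yv PS.^ l) (Y-power l)
  Q-power (suc k) l = *-power Q (mono 0 0 (suc k) l 0) (mono 0 0 k l 0) k (Yv PS.^ l) (Q-mono k l) (Q-power k l)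

  T-power : ∀ j k l → mono 0 j k l 0 ≈ (T PS.^ j) ⊛ ((Q PS.^ k) ⊛ (Yv PS.^ l))
  T-power zero    k l = 1*-power (mono 0 0 k l 0) ((Q PS.^ k) ⊛ (Yv PS.^ l)) (Q-power k l)
  T-power (suc j) k l = *-power T (mono 0 (suc j) k l 0) (mono 0 j k l 0) j ((Q PS.^ k) ⊛ (Yv PS.^ l)) (T-mono j k l) (T-power j k l)

-- The variables are split off in the order s, t, q, Y, which produces the nesting of the terms of
-- `permSum`.
mono-^ : ∀ i j k l → mono i j k l 0 ≈ (S PS.^ i) ⊛ ((T PS.^ j) ⊛ ((Q PS.^ k) ⊛ (Yv PS.^ l)))
mono-^ zero    j k l = 1*-power (mono 0 j k l 0) ((T PS.^ j) ⊛ ((Q PS.^ k) ⊛ (Yv PS.^ l))) (T-power j k l)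
mono-^ (suc i) j k l = *-power S (mono (suc i) j k l 0) (mono i j k l 0) i ((T PS.^ j) ⊛ ((Q PS.^ k) ⊛ (Yv PS.^ l))) (S-mono i j k l) (mono-^ i j k l)

module D = HookDistribution psAlgebra
module ST = SeriesTheory psAlgebra

pow-^ : ∀ x n → pow x n ≈ x PS.^ n
pow-^ x zero    = PS.refl {𝟙}
pow-^ x (suc n) = PS.trans {pow x n ⊛ x} {(x PS.^ n) ⊛ x} {x PS.^ suc n}
  (PS.*-congʳ {x} {pow x n} {x PS.^ n} (pow-^ x n)) (PS.*-comm (x PS.^ n) x)

poch-pochᵣ : ∀ a n → poch a n ≈ ST.pochᵣ a n
poch-pochᵣ a zero    = PS.refl {𝟙}
poch-pochᵣ a (suc n) = PS.*-cong {poch a n} {ST.pochᵣ a n} {𝟙 ⊖ a ⊛ pow Q n} {𝟙 ⊖ a ⊛ (Q PS.^ n)}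
  (poch-pochᵣ a n) (⊖-congˡ {𝟙} {a ⊛ pow Q n} {a ⊛ (Q PS.^ n)} (PS.*-congˡ {a} {pow Q n} {Q PS.^ n} (pow-^ Q n)))
  where
  ⊖-congˡ : ∀ {f x y} → x ≈ y → f ⊖ x ≈ f ⊖ y
  ⊖-congˡ {f} p a b c d e = cong (λ k → f a b c d e ℤ.- k) (p a b c d e)

permPoly-permSum : ∀ n → permPoly n ≈ D.permSum n
permPoly-permSum n = ST.Σ-cong (perms n) {λ σ → mono (lec σ) (ides σ) (imaj σ) (pix σ) 0}
  {λ σ → (S PS.^ lec σ) ⊛ ((T PS.^ ides σ) ⊛ ((Q PS.^ imaj σ) ⊛ (Yv PS.^ pix σ)))}
  (λ {σ} _ → mono-^ (lec σ) (ides σ) (imaj σ) (pix σ))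

numer-numerᵣ : ∀ r → numer r ≈ D.numerᵣ r
numer-numerᵣ r = PS.*-cong {(𝟙 ⊖ Q ⊛ S) ⊛ poch U r} {(𝟙 ⊖ Q ⊛ S) ⊛ ST.pochᵣ U r} {poch (U ⊛ S ⊛ Q) r} {ST.pochᵣ (U ⊛ S ⊛ Q) r}
  (PS.*-congˡ {𝟙 ⊖ Q ⊛ S} {poch U r} {ST.pochᵣ U r} (poch-pochᵣ U r)) (poch-pochᵣ (U ⊛ S ⊛ Q) r)

denom-denomᵣ : ∀ r → denom r ≈ D.denomᵣ r
denom-denomᵣ r = PS.*-cong
  {poch U r ⊖ S ⊛ Q ⊛ poch (U ⊛ S ⊛ Q) r} {ST.pochᵣ U r ⊖ S ⊛ Q ⊛ ST.pochᵣ (U ⊛ S ⊛ Q) r}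
  {poch (U ⊛ Yv) (suc r)} {ST.pochᵣ (U ⊛ Yv) (suc r)}
  (λ a b c d e → ≡.cong₂ ℤ._-_ (poch-pochᵣ U r a b c d e)
    (PS.*-congˡ {S ⊛ Q} {poch (U ⊛ S ⊛ Q) r} {ST.pochᵣ (U ⊛ S ⊛ Q) r} (poch-pochᵣ (U ⊛ S ⊛ Q) r) a b c d e))
  (poch-pochᵣ (U ⊛ Yv) (suc r))

theorem1p2 : (G H : ℕ → PS)
    → (∀ r → denom r ⊛ G r ≈ numer r)
    → (∀ n → poch T (suc n) ⊛ H n ≈ 𝟙)
    → tsum G ≈ usum (λ n → permPoly n ⊛ H n)
theorem1p2 G H hG hH =
  PS.trans {tsum G} {usum (λ n → D.permSum n ⊛ H n)} {usum (λ n → permPoly n ⊛ H n)}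
    (D.hook-distribution G H hG′ hH′)
    (SeriesAlgebra.usum-cong psAlgebra {λ n → D.permSum n ⊛ H n} {λ n → permPoly n ⊛ H n}
      (λ n → PS.*-congʳ {H n} {D.permSum n} {permPoly n} (PS.sym {permPoly n} {D.permSum n} (permPoly-permSum n))))
  where
  hG′ : ∀ r → D.denomᵣ r ⊛ G r ≈ D.numerᵣ r
  hG′ r = PS.trans {D.denomᵣ r ⊛ G r} {denom r ⊛ G r} {D.numerᵣ r}
    (PS.*-congʳ {G r} {D.denomᵣ r} {denom r} (PS.sym {denom r} {D.denomᵣ r} (denom-denomᵣ r)))
    (PS.trans {denom r ⊛ G r} {numer r} {D.numerᵣ r} (hG r) (numer-numerᵣ r))
  hH′ : ∀ n → ST.pochᵣ T (suc n) ⊛ H n ≈ 𝟙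
  hH′ n = PS.trans {ST.pochᵣ T (suc n) ⊛ H n} {poch T (suc n) ⊛ H n} {𝟙}
    (PS.*-congʳ {H n} {ST.pochᵣ T (suc n)} {poch T (suc n)} (PS.sym {poch T (suc n)} {ST.pochᵣ T (suc n)} (poch-pochᵣ T (suc n)))) (hH n)
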